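{- For every $n\in\mathbb N$ there is a cyclically $5$-edge connected permutation snark $G$ of order $10+24n$. Moreover, $G$ has a permutation $2$-factor which is not contained in any circuit double cover of $G$.
   Context: A circuit is a $2$-regular $2$-connected graph. A circuit double cover (CDC) of a cubic graph $G$ is a set $S$ of circuits of $G$ such that every edge of $G$ is covered by exactly two circuits of $S$. A $2$-regular subgraph $D$ of $G$ is contained in $S$ if every circuit (component) of $D$ is an element of $S$. A cubic graph $G$ with a $2$-factor $F_2$ consisting of two chordless circuits is called a cycle permutation graph, and $F_2$ is called a permutation $2$-factor of $G$. A snark is (as usual) a cyclically $4$-edge connected cubic graph of girth at least $5$ that is not $3$-edge colorable. A permutation snark is a cycle permutation graph that is a snark. For a graph $G$ containing two vertex-disjoint circuits, the cyclic edge-connectivity $\lambda_c(G)$ is the minimum number of edges one needs to delete from $G$ in order to obtain two components each of which contains a circuit; $G$ is cyclically $k$-edge connected if $\lambda_c(G)\ge k$. The order of a graph is its number of vertices. -}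

module Defs where

open import Data.Nat using (ℕ; _≤_)
open import Data.Fin using (Fin)
open import Data.Fin.Properties using (_≟_)
open import Data.Fin.Subset using (Subset; ⊤; ⊥; _∈_; _⊆_; _∩_; _∪_; _─_; _-_; ∁; ∣_∣; Nonempty)
open import Data.Fin.Subset.Properties using (_∈?_)
open import Data.List using (List; length; filter)
open import Data.List.Relation.Unary.All using (All)
open import Data.List.Relation.Unary.Unique.Propositional using (Unique)
import Data.List.Membership.Propositional as List
open import Data.Product using (_×_; _,_; ∃; ∃-syntax; proj₁; proj₂)
open import Data.Sum using (_⊎_)
open import Data.Vec using (tabulate)
open import Relation.Binary.Construct.Closure.ReflexiveTransitive using (Star)
open import Relation.Binary.PropositionalEquality using (_≡_; _≢_)
open import Relation.Nullary using (¬_; Dec; does)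
open import Relation.Nullary.Decidable using (_⊎-dec_)

-- Finite simple graphs. Edges are labelled so that edge sets are Subsets; the
-- order in which `ends` lists the two ends of an edge carries no meaning.
record Graph : Set where
  field
    order : ℕ
    size  : ℕ
    ends  : Fin size → Fin order × Fin order

  Incident : Fin order → Fin size → Set
  Incident v e = v ≡ proj₁ (ends e) ⊎ v ≡ proj₂ (ends e)

  field
    loopless   : ∀ e → proj₁ (ends e) ≢ proj₂ (ends e)
    noParallel : ∀ e f → (∀ v → Incident v e → Incident v f) → e ≡ f

  incident? : ∀ v e → Dec (Incident v e)
  incident? v e = (v ≟ proj₁ (ends e)) ⊎-dec (v ≟ proj₂ (ends e))

  edgesAt : Fin order → Subset size
  edgesAt v = tabulate (λ e → does (incident? v e))

module _ (G : Graph) where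
  open Graph G

  -- A vertex set and an edge set. Being a subgraph is the separate predicate
  -- IsSubgraph, so that _≡_ on this type is equality of the two sets.
  record Part : Set where
    constructor part
    field
      verts : Subset order
      edges : Subset size

  open Part

  IsSubgraph : Part → Set
  IsSubgraph H = ∀ {v e} → e ∈ edges H → Incident v e → v ∈ verts H

  _⊑_ : Part → Part → Set
  H ⊑ K = verts H ⊆ verts K × edges H ⊆ edges K

  whole : Part
  whole = part ⊤ ⊤

  deleteVertex : Part → Fin order → Part
  deleteVertex H x = part (verts H - x) (edges H ─ edgesAt x)

  deleteEdges : Subset size → Part
  deleteEdges X = part ⊤ (∁ X)

  degree : Part → Fin order → ℕ
  degree H v = ∣ edgesAt v ∩ edges H ∣

  Regular : ℕ → Part → Set
  Regular k H = ∀ v → v ∈ verts H → degree H v ≡ k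

  Adjacent : Part → Fin order → Fin order → Set
  Adjacent H u v = ∃[ e ] e ∈ edges H × (ends e ≡ (u , v) ⊎ ends e ≡ (v , u))

  Connected : Part → Set
  Connected H = Nonempty (verts H)
              × (∀ u v → u ∈ verts H → v ∈ verts H → Star (Adjacent H) u v)

  TwoConnected : Part → Set
  TwoConnected H = 3 ≤ ∣ verts H ∣
                 × Connected H
                 × (∀ x → x ∈ verts H → Connected (deleteVertex H x))

  IsCircuit : Part → Set
  IsCircuit C = IsSubgraph C × Regular 2 C × TwoConnected C

  IsComponent : Part → Part → Set
  IsComponent K H = IsSubgraph K × K ⊑ H × Connected K
                  × (∀ L → IsSubgraph L → L ⊑ H → Connected L → K ⊑ L → L ⊑ K)

  Cubic : Set
  Cubic = Regular 3 whole

  -- With the lower bound g on all circuits, an acyclic graph has infinite girth.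
  GirthAtLeast : ℕ → Set
  GirthAtLeast g = ∀ C → IsCircuit C → g ≤ ∣ edges C ∣

  EdgeColourable : ℕ → Set
  EdgeColourable k =
    ∃ λ (c : Fin size → Fin k) →
      ∀ e f → e ≢ f → (∃[ v ] Incident v e × Incident v f) → c e ≢ c f

  VertexDisjoint : Part → Part → Set
  VertexDisjoint H K = verts H ∩ verts K ≡ ⊥

  ContainsCircuit : Part → Set
  ContainsCircuit H = ∃[ C ] IsCircuit C × C ⊑ H

  IsCyclicCut : Subset size → Set
  IsCyclicCut X =
    ∃[ K ] ∃[ L ] K ≢ L
      × IsComponent K (deleteEdges X) × ContainsCircuit K
      × IsComponent L (deleteEdges X) × ContainsCircuit L

  -- λ_c(G) ≥ k, where λ_c(G) is the minimum of ∣ X ∣ over the cyclic cuts X. It is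
  -- defined only if G has two vertex-disjoint circuits, hence the first conjunct.
  CyclicallyEdgeConnected : ℕ → Set
  CyclicallyEdgeConnected k =
      (∃[ C ] ∃[ D ] IsCircuit C × IsCircuit D × VertexDisjoint C D)
    × (∀ X → IsCyclicCut X → k ≤ ∣ X ∣)

  IsTwoFactor : Part → Set
  IsTwoFactor F = IsSubgraph F × verts F ≡ ⊤ × Regular 2 F

  Chordless : Part → Set
  Chordless C = ∀ e → (∀ v → Incident v e → v ∈ verts C) → e ∈ edges C

  IsPermutationTwoFactor : Part → Set
  IsPermutationTwoFactor F =
    IsTwoFactor F
    × ∃[ C ] ∃[ D ] IsCircuit C × Chordless C
                  × IsCircuit D × Chordless D
                  × VertexDisjoint C D
                  × F ≡ part (verts C ∪ verts D) (edges C ∪ edges D)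

  CyclePermutationGraph : Set
  CyclePermutationGraph = Cubic × ∃[ F ] IsPermutationTwoFactor F

  Snark : Set
  Snark = Cubic × CyclicallyEdgeConnected 4 × GirthAtLeast 5 × ¬ EdgeColourable 3

  PermutationSnark : Set
  PermutationSnark = CyclePermutationGraph × Snark

  -- A set of circuits is a list without repetitions, so that the length below
  -- counts distinct circuits.
  IsCircuitDoubleCover : List Part → Set
  IsCircuitDoubleCover S =
    Unique S × All IsCircuit S
    × (∀ e → length (filter (λ C → e ∈? edges C) S) ≡ 2)

  ContainedIn : Part → List Part → Set
  ContainedIn D S = ∀ C → IsComponent C D → C List.∈ S

{-# OPTIONS --safe #-}
module Submission where

-- In a circuit double cover containing the two cycles C and D of a cycle permutation graph, label
-- each edge of C and D by the other circuit through it. At a matching edge uv the two labels at u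
-- are distinct and are, as a pair, the two labels at v. A 3-edge-colouring also is such a labelling,
-- so it suffices to find permutations that admit none.
--
-- The Petersen graph admits none. Three of its matching edges, consecutive on C and such that the
-- first and the third are adjacent on D, form a block that meets the rest of the graph in six edges
-- of C and D. A certain block of fifteen matching edges constrains the labels of its six outer edges
-- at least as much, and contains a copy of the small block; so the small block can be replaced by
-- the large one again and again, each time adding 24 vertices.
--
-- Girth and cyclic connectivity only need that no set of at least two and at most k − 2 of the k
-- matching edges is an interval both on C and on D. A 2-colouring of the matching edges that changes
-- at most twice along C and along D is read by a finite automaton, one layer of twelve at a time.

-- The labels of a double cover are circuits, of which there is no fixed supply. The impossibility
-- proofs therefore run over an arbitrary type `L`: the search assigns no values, it branches on the
-- two ways in which each pair can match, records the equalities and drops a branch once two labels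
-- that must differ coincide. Circuits and colours are two instances of the same statement.
--
-- Intervals decide connectivity for the following reason. Colour the vertices by the side of a cut
-- on which they lie. A cycle that meets both sides loses at least two edges. If both cycles do, at
-- most four cut edges means two from each and no matching edge, so each side is an interval of
-- matching edges on both cycles; a side with a single matching edge has two vertices and no
-- circuit. If some cycle lies on one side, a circuit on the other side must be the whole other
-- cycle, and then every matching edge is cut.

open import Defs
open import Data.Bool using (Bool; true; false; T; _∧_; _∨_; not; _xor_; if_then_else_)
import Data.Bool.Properties as Bool
open import Data.Bool.Properties using (T-∧; T-∨)
open import Data.Bool.ListAction using (any; all)
open import Data.Nat using (ℕ; zero; suc; _+_; _*_; _≤_; _<_; _≡ᵇ_; _≤ᵇ_; _<ᵇ_; z≤n; s≤s)
import Data.Nat.Properties as ℕ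
open import Data.Nat.DivMod using (_mod_; _%_; m%n<n; m<n⇒m%n≡m; n%n≡0)
open import Data.Nat.Tactic.RingSolver using (solve-∀)
open import Data.Fin as Fin
  using (Fin; zero; suc; toℕ; fromℕ; fromℕ<; inject₁; cast; punchOut; _↑ˡ_; _↑ʳ_; splitAt; join)
open import Data.Fin.Properties as Fin
  using (toℕ-inject₁; toℕ-fromℕ; toℕ-fromℕ<; toℕ-injective; toℕ-cast; toℕ<n; splitAt-↑ˡ; splitAt-↑ʳ;
         join-splitAt; punchOut-injective; injective⇒≤; any?; all?)
open import Data.Fin.Induction using (<-weakInduction; >-weakInduction)
open import Data.Fin.Relation.Unary.Top using (view; view-fromℕ; view-inject₁; ‵fromℕ; ‵inject₁)
open import Data.Fin.Subset
  using (Subset; Empty; Nonempty; ⊤; ⁅_⁆; ∁; ∣_∣; _∈_; _∉_; _⊆_; _∩_; _∪_; _─_; _-_)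
open import Data.Fin.Subset.Properties
open import Data.List as List using (List; []; _∷_; _++_; applyUpTo; filter; length; map; upTo)
import Data.List.Membership.Propositional as List
open import Data.List.Membership.Propositional.Properties
  using (∈-filter⁺; ∈-filter⁻; ∈-lookup; ∈-map⁺; ∈-++⁺ˡ; ∈-++⁺ʳ)
open import Data.List.Properties using (length-map; length-++; map-++; map-∘)
open import Data.List.Relation.Unary.All as All using (All; []; _∷_)
import Data.List.Relation.Unary.All.Properties as All
open import Data.List.Relation.Unary.AllPairs using ([]; _∷_)
open import Data.List.Relation.Unary.Any as Any using (Any; here; there; index)
open import Data.List.Relation.Unary.Any.Properties using (any⁻; lookup-index)
open import Data.List.Relation.Unary.Unique.Propositional using (Unique)
import Data.List.Relation.Unary.Unique.Propositional.Properties as Unique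
open import Data.Product using (_×_; _,_; proj₁; proj₂; ∃-syntax; map₂)
open import Data.Product.Properties using (≡-dec)
open import Data.Sum using (_⊎_; inj₁; inj₂; [_,_]′; swap)
open import Data.Vec using (Vec; []; _∷_; here; there; lookup; tabulate)
open import Data.Vec.Properties using (lookup∘tabulate; tabulate∘lookup; tabulate-cong; lookup⇒[]=; []=⇒lookup)
open import Function using (_∘_; id)
open import Function.Bundles using (Equivalence)
open import Relation.Binary.Construct.Closure.ReflexiveTransitive as Star
  using (Star; ε; _◅_; _◅◅_; reverse)
open import Relation.Binary.Definitions using (DecidableEquality; tri<; tri≈; tri>)
open import Relation.Binary.PropositionalEquality
  using (_≡_; _≢_; refl; sym; trans; cong; cong₂; subst; ≢-sym; module ≡-Reasoning)
open import Relation.Nullary using (¬_; Dec; yes; no; does; contradiction)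
open import Relation.Nullary.Decidable
  using (dec-true; dec-false; decidable-stable; toWitness; ¬?; _→-dec_; _×-dec_; _⊎-dec_)

-- Verified search for labellings

SamePair : {L : Set} → L → L → L → L → Set
SamePair a b c d = (a ≡ c × b ≡ d) ⊎ (a ≡ d × b ≡ c)

Matched : {L : Set} → L → L → L → L → Set
Matched a b c d = a ≢ b × SamePair a b c d

infix 6 _—_≋_—_

data Constraint : Set where
  _—_≋_—_ : ℕ → ℕ → ℕ → ℕ → Constraint

Holds : {L : Set} → (ℕ → L) → Constraint → Set
Holds ρ (p — q ≋ r — s) = Matched (ρ p) (ρ q) (ρ r) (ρ s)

nth : {A : Set} → List A → A → ℕ → A
nth []       d i       = d
nth (x ∷ xs) d zero    = x
nth (x ∷ xs) d (suc i) = nth xs d i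

-- A table lists, for each label, a representative label known to be equal to it.
Table : Set
Table = List ℕ

rep : Table → ℕ → ℕ
rep t i = nth t i i

rename : ℕ → ℕ → ℕ → ℕ
rename a b x = if x ≡ᵇ a then b else x

identify : ℕ → ℕ → Table → Table
identify x y t = go (rep t x) (rep t y)
  where
  go : ℕ → ℕ → Table
  go a b = map (rename a b) t

sameRep : Table → ℕ → ℕ → Bool
sameRep t x y = rep t x ≡ᵇ rep t y

inconsistent : Table → Constraint → Bool
inconsistent t (p — q ≋ r — s) = sameRep t p q ∨ sameRep t r s

samePairs : Table → ℕ → ℕ → ℕ → ℕ → Bool
samePairs t p q r s = (sameRep t p r ∧ sameRep t q s) ∨ (sameRep t p s ∧ sameRep t q r)

separates : Table → ℕ → ℕ → Constraint → Bool
separates t x y (p — q ≋ r — s) = samePairs t x y p q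

-- Inequalities come only from the constraints: `p` and `q` count as distinct when they are, as a
-- pair, the left pair of some member of `cs`.
entails : List Constraint → Table → Constraint → Bool
entails cs t (p — q ≋ r — s) =
  any (separates t p q) cs ∧ samePairs t p q r s

module _ (cs : List Constraint) (goals : List (List Constraint)) where

  mutual
    -- A leaf must entail all of one goal. With `goals` empty no leaf succeeds, so acceptance then
    -- means that every branch is pruned: the constraints are contradictory.
    search : List Constraint → Table → Bool
    search []                    t = any (all (entails cs t)) goals
    search ((p — q ≋ r — s) ∷ todo) t =
      visit todo (identify p r (identify q s t)) ∧ visit todo (identify p s (identify q r t))

    visit : List Constraint → Table → Bool
    visit todo t = any (inconsistent t) cs ∨ search todo t

-- Soundness of the search

module _ {L : Set} (ρ : ℕ → L) where

  record Sound (t : Table) : Set where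
    constructor sound
    field represents : ∀ i → ρ (rep t i) ≡ ρ i
  open Sound

  rename-sound : ∀ {a b} → ρ a ≡ ρ b → ∀ x → ρ (rename a b x) ≡ ρ x
  rename-sound {a} {b} eq x with x ≡ᵇ a in p
  ... | false = refl
  ... | true  = trans (sym eq) (cong ρ (sym (ℕ.≡ᵇ⇒≡ x a (subst T (sym p) _))))

  nth-map-sound : ∀ {f : ℕ → ℕ} → (∀ x → ρ (f x) ≡ ρ x) →
                  ∀ t d i → ρ (nth (map f t) d i) ≡ ρ (nth t d i)
  nth-map-sound h []      d i       = refl
  nth-map-sound h (x ∷ t) d zero    = h x
  nth-map-sound h (x ∷ t) d (suc i) = nth-map-sound h t d i

  identify-sound : ∀ x y {t} → ρ x ≡ ρ y → Sound t → Sound (identify x y t)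
  identify-sound x y {t} eq (sound snd) = sound λ i →
    trans (nth-map-sound (rename-sound (trans (snd x) (trans eq (sym (snd y))))) t i i) (snd i)

  sameRep-sound : ∀ {t} → Sound t → ∀ x y → T (sameRep t x y) → ρ x ≡ ρ y
  sameRep-sound (sound snd) x y eq = trans (sym (snd x)) (trans (cong ρ (ℕ.≡ᵇ⇒≡ _ _ eq)) (snd y))

  samePairs-sound : ∀ {t} → Sound t → ∀ p q r s → T (samePairs t p q r s) →
                    SamePair (ρ p) (ρ q) (ρ r) (ρ s)
  samePairs-sound {t} snd p q r s ok
    with Equivalence.to (T-∨ {sameRep t p r ∧ sameRep t q s}) ok
  ... | inj₁ h = let u , v = Equivalence.to (T-∧ {sameRep t p r}) h in
                 inj₁ (sameRep-sound snd p r u , sameRep-sound snd q s v)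
  ... | inj₂ h = let u , v = Equivalence.to (T-∧ {sameRep t p s}) h in
                 inj₂ (sameRep-sound snd p s u , sameRep-sound snd q r v)

  module _ (cs : List Constraint) (goals : List (List Constraint)) (holds : All (Holds ρ) cs) where

    consistent : ∀ {t} → Sound t → ¬ T (any (inconsistent t) cs)
    consistent {t} snd bad = refute _ (proj₁ found) (proj₂ found)
      where
      found = All.lookupAny holds (any⁻ (inconsistent t) cs bad)
      refute : ∀ c → Holds ρ c → ¬ T (inconsistent t c)
      refute (p — q ≋ r — s) (p≢q , sp) inc
        with Equivalence.to (T-∨ {sameRep t p q}) inc | sp
      ... | inj₁ e | _                = p≢q (sameRep-sound snd p q e)
      ... | inj₂ e | inj₁ (p≡r , q≡s) = p≢q (trans p≡r (trans (sameRep-sound snd r s e) (sym q≡s)))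
      ... | inj₂ e | inj₂ (p≡s , q≡r) = p≢q (trans p≡s (trans (sym (sameRep-sound snd r s e)) (sym q≡r)))

    separates-sound : ∀ {t} → Sound t → ∀ x y → T (any (separates t x y) cs) → ρ x ≢ ρ y
    separates-sound {t} snd x y ok x≡y = refute _ (proj₁ found) (proj₂ found)
      where
      found = All.lookupAny holds (any⁻ (separates t x y) cs ok)
      refute : ∀ c → Holds ρ c → ¬ T (separates t x y c)
      refute (p — q ≋ r — s) (p≢q , _) sep with samePairs-sound snd x y p q sep
      ... | inj₁ (x≡p , y≡q) = p≢q (trans (sym x≡p) (trans x≡y y≡q))
      ... | inj₂ (x≡q , y≡p) = p≢q (trans (sym y≡p) (trans (sym x≡y) x≡q))

    entails-sound : ∀ {t} → Sound t → ∀ c → T (entails cs t c) → Holds ρ c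
    entails-sound {t} snd (p — q ≋ r — s) ok =
      let u , v = Equivalence.to (T-∧ {any (separates t p q) cs}) ok
      in separates-sound snd p q u , samePairs-sound snd p q r s v

    mutual
      search-sound : ∀ todo t → All (Holds ρ) todo → Sound t →
                     T (search cs goals todo t) → Any (All (Holds ρ)) goals
      search-sound [] t [] snd ok =
        Any.map (λ {g} h → All.map (λ {c} → entails-sound snd c) (All.all⁺ (entails cs t) g h))
                (any⁻ (all (entails cs t)) goals ok)
      search-sound ((p — q ≋ r — s) ∷ todo) t ((_ , sp) ∷ hs) snd ok
        with Equivalence.to (T-∧ {visit cs goals todo (identify p r (identify q s t))}) ok | sp
      ... | u , _ | inj₁ (p≡r , q≡s) =
        visit-sound todo _ hs (identify-sound p r p≡r (identify-sound q s q≡s snd)) u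
      ... | _ , v | inj₂ (p≡s , q≡r) =
        visit-sound todo _ hs (identify-sound p s p≡s (identify-sound q r q≡r snd)) v

      visit-sound : ∀ todo t → All (Holds ρ) todo → Sound t →
                    T (visit cs goals todo t) → Any (All (Holds ρ)) goals
      visit-sound todo t hs snd ok with Equivalence.to (T-∨ {any (inconsistent t) cs}) ok
      ... | inj₁ bad = contradiction bad (consistent snd)
      ... | inj₂ ok′ = search-sound todo t hs snd ok′

-- The permutations

-- Matching edges are numbered along C, and `word n` lists them along D. The numbers from 3 on are
-- given by `marker` and `arc`, diminished by 3, so that a new layer adds 12 to all of them.
marker : ℕ → ℕ
marker zero    = 0
marker (suc n) = 4

arc-head : ℕ → ℕ
arc-head zero    = 1
arc-head (suc n) = 10

arc-tail : ℕ → List ℕ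
arc-tail zero    = []
arc-tail (suc n) = 7 ∷ 9 ∷ 2 ∷ 0 ∷ 3 ∷ 12 + marker n ∷ 6 ∷
                   map (12 +_) (arc-head n ∷ arc-tail n) ++ 11 ∷ 1 ∷ 5 ∷ 8 ∷ []

arc : ℕ → List ℕ
arc n = arc-head n ∷ arc-tail n

word : ℕ → List ℕ
word n = 2 ∷ 0 ∷ 3 + marker n ∷ 1 ∷ map (3 +_) (arc n)

len : ℕ → ℕ
len n = 5 + n * 12

-- The labels along D are witnesses inside the chain and not a function of the position, so segments
-- of the word can be split off and rejoined without renumbering.
Chain : {L : Set} → (ℕ → L → L → Set) → L → List ℕ → L → Set
Chain R a []       b = a ≡ b
Chain R a (x ∷ xs) b = ∃[ c ] R x a c × Chain R c xs b

module _ {L : Set} {R : ℕ → L → L → Set} where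

  Chain-map : ∀ (f : ℕ → ℕ) a xs b → Chain R a (map f xs) b → Chain (R ∘ f) a xs b
  Chain-map f a []       b e           = e
  Chain-map f a (x ∷ xs) b (c , r , t) = c , r , Chain-map f c xs b t

  Chain-map⁺ : ∀ (f : ℕ → ℕ) a xs b → Chain (R ∘ f) a xs b → Chain R a (map f xs) b
  Chain-map⁺ f a []       b e           = e
  Chain-map⁺ f a (x ∷ xs) b (c , r , t) = c , r , Chain-map⁺ f c xs b t

  Chain-split : ∀ a xs ys b → Chain R a (xs ++ ys) b → ∃[ c ] Chain R a xs c × Chain R c ys b
  Chain-split a []       ys b t           = a , refl , t
  Chain-split a (x ∷ xs) ys b (c , r , t) =
    let d , u , v = Chain-split c xs ys b t in d , (c , r , u) , v

Chain-lookup : ∀ {L : Set} {R : ℕ → L → L → Set} (f : ℕ → L) xs →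
  (∀ j → R (List.lookup xs j) (f (toℕ j)) (f (suc (toℕ j)))) → Chain R (f 0) xs (f (length xs))
Chain-lookup f []       h = refl
Chain-lookup f (x ∷ xs) h = f 1 , h zero , Chain-lookup (f ∘ suc) xs (h ∘ suc)

Rung : {L : Set} → (ℕ → L) → ℕ → L → L → Set
Rung A x = Matched (A x) (A (suc x))

-- `A x` labels the edge of C before the matching edge `x`. The equation `A 0 ≡ A (len n)` closes C,
-- and the common endpoint `b` of the chain closes D.
Realisation : ℕ → Set → Set
Realisation n L = ∃[ A ] A 0 ≡ A (len n) × ∃[ b ] Chain (Rung {L} A) b (word n) b

-- Unrealisability, by contracting one layer at a time

nth-upTo : ∀ (f : ℕ → ℕ) n i → nth (applyUpTo f n) (f i) i ≡ f i
nth-upTo f zero    i       = refl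
nth-upTo f (suc n) zero    = refl
nth-upTo f (suc n) (suc i) = nth-upTo (f ∘ suc) n i

identity-sound : ∀ {L : Set} (ρ : ℕ → L) n → Sound ρ (upTo n)
identity-sound ρ n = sound λ i → cong ρ (nth-upTo id n i)

solve : ∀ {L : Set} cs goals n → T (search cs goals cs (upTo n)) →
        (ρ : ℕ → L) → All (Holds ρ) cs → Any (All (Holds ρ)) goals
solve cs goals n ok ρ hs = search-sound ρ cs goals hs cs (upTo n) hs (identity-sound ρ n) ok

-- Labels 0 to 4 are the edges of C, 5 to 9 those of D in the order of `word 0`, which is 2 0 3 1 4.
-- It advances by three modulo five at each step, so D is the pentagram of the Petersen graph.
petersen : List Constraint
petersen = 2 — 3 ≋ 5 — 6 ∷ 0 — 1 ≋ 6 — 7 ∷ 3 — 4 ≋ 7 — 8 ∷ 1 — 2 ≋ 8 — 9 ∷ 4 — 0 ≋ 9 — 5 ∷ []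

-- Label i ≤ 15 is the edge of C before i; the labels 16 to 30 are those along the path
-- 14 4 8 11 2 0 7 1 13 10 12 5 3 6 of D, and 31, 32 are those around 9 on D.
block : List Constraint
block =
   14 — 15 ≋ 16 — 17 ∷  4 —  5 ≋ 17 — 18 ∷  8 —  9 ≋ 18 — 19 ∷ 11 — 12 ≋ 19 — 20 ∷
    2 —  3 ≋ 20 — 21 ∷  0 —  1 ≋ 21 — 22 ∷  7 —  8 ≋ 22 — 23 ∷  1 —  2 ≋ 23 — 24 ∷
   13 — 14 ≋ 24 — 25 ∷ 10 — 11 ≋ 25 — 26 ∷ 12 — 13 ≋ 26 — 27 ∷  5 —  6 ≋ 27 — 28 ∷
    3 —  4 ≋ 28 — 29 ∷  6 —  7 ≋ 29 — 30 ∷  9 — 10 ≋ 31 — 32 ∷ []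

-- The rungs 0, 1, 2 of the small block, attached to the outer labels of `block`: 0 and 15 on C, 16
-- and 30 at the ends of the path on D, 31 and 32 around the separate vertex. The inner labels `a₁`,
-- `a₂`, `b₁` are named by labels of `block`, so that the search can verify the choice.
contracted : ℕ → ℕ → ℕ → List Constraint
contracted a₁ a₂ b₁ = 0 — a₁ ≋ b₁ — 30 ∷ a₁ — a₂ ≋ 31 — 32 ∷ a₂ — 15 ≋ 16 — b₁ ∷ []

-- Obtained by inspecting the solutions of `block`: these three cases cover all of them.
contractions : List (List Constraint)
contractions = contracted 15 16 15 ∷ contracted 30 16 0 ∷ contracted 30 0 0 ∷ []

petersen-unrealisable : {L : Set} → ¬ Realisation 0 L
petersen-unrealisable {L} (A , A₀ , b₀ , b₁ , r₂ , b₂ , r₀ , b₃ , r₃ , b₄ , r₁ , b₅ , r₄ , b≡)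
  with solve petersen [] 10 _ (nth (A 0 ∷ A 1 ∷ A 2 ∷ A 3 ∷ A 4 ∷ b₀ ∷ b₁ ∷ b₂ ∷ b₃ ∷ b₄ ∷ []) b₀)
       (r₂ ∷ r₀ ∷ r₃ ∷ r₁ ∷ subst (λ a → Matched (A 4) a b₄ b₀) (sym A₀)
          (subst (Matched (A 4) (A 5) b₄) b≡ r₄) ∷ [])
... | ()

Contracted : {L : Set} → L → L → L → L → L → L → Set
Contracted {L} a₀ a₃ b₀ b₂ c₀ c₁ = ∃[ a₁ ] ∃[ a₂ ] ∃[ b₁ ]
  Matched a₀ a₁ b₁ b₂ × Matched a₁ a₂ c₀ c₁ × Matched a₂ a₃ b₀ b₁

contract : ∀ {L : Set} (ρ : ℕ → L) → All (Holds ρ) block →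
           Contracted (ρ 0) (ρ 15) (ρ 16) (ρ 30) (ρ 31) (ρ 32)
contract ρ hs with solve block contractions 33 _ ρ hs
... | here (p ∷ q ∷ r ∷ [])                 = _ , _ , _ , p , q , r
... | there (here (p ∷ q ∷ r ∷ []))         = _ , _ , _ , p , q , r
... | there (there (here (p ∷ q ∷ r ∷ []))) = _ , _ , _ , p , q , r

-- Matching on the numerals makes the value at `3 + x` compute to `A x`, so the rungs of the marker
-- and of the arc carry over as they are.
graft : {L : Set} → L → L → L → (ℕ → L) → ℕ → L
graft a₀ a₁ a₂ A 0                   = a₀
graft a₀ a₁ a₂ A 1                   = a₁
graft a₀ a₁ a₂ A 2                   = a₂
graft a₀ a₁ a₂ A (suc (suc (suc x))) = A x

-- Subscripts follow the numbering of `block`, with `b` as label 20 and `c` as label 16. Cyclically,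
-- D runs through the inner arc, the path from 14 to 6, the inner marker and 9. Restarting the chain
-- at `c`, the label after the inner arc, puts the path where `word n` has 2 0, and 9 where it has
-- 1.
contract-layer : ∀ {L : Set} n → Realisation (suc n) L → Realisation n L
contract-layer n
  (A , A₀ , b , b₂₁ , r₂ , b₂₂ , r₀ , b₂₃ , r₇ , b₂₄ , r₁ , b₂₅ , r₁₃ , b₂₆ , r₁₀ , b₂₇ , r₁₂ ,
   b₂₈ , r₅ , b₂₉ , r₃ , b₃₀ , r₆ , b₃₁ , rₘ , b₃₂ , r₉ , rest)
  with Chain-split b₃₂ (map (12 +_) (arc n)) _ b (Chain-map (3 +_) b₃₂ _ b rest)
... | c , inner , b₁₇ , r₁₄ , b₁₈ , r₄ , b₁₉ , r₈ , b₂₀ , r₁₁ , refl =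
  graft (A 0) a₁ a₂ (A ∘ (15 +_)) , A₀ , c , b₁ , s₂ , b₃₀ , s₀ , b₃₁ , rₘ , b₃₂ , s₁ ,
  Chain-map⁺ (3 +_) b₃₂ (arc n) c (Chain-map (12 +_) b₃₂ (arc n) c inner)
  where
  labels = A 0 ∷ A 1 ∷ A 2 ∷ A 3 ∷ A 4 ∷ A 5 ∷ A 6 ∷ A 7 ∷ A 8 ∷ A 9 ∷ A 10 ∷ A 11 ∷ A 12 ∷
           A 13 ∷ A 14 ∷ A 15 ∷ c ∷ b₁₇ ∷ b₁₈ ∷ b₁₉ ∷ b₂₀ ∷ b₂₁ ∷ b₂₂ ∷ b₂₃ ∷ b₂₄ ∷ b₂₅ ∷
           b₂₆ ∷ b₂₇ ∷ b₂₈ ∷ b₂₉ ∷ b₃₀ ∷ b₃₁ ∷ b₃₂ ∷ []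
  contracted-block : Contracted (A 0) (A 15) c b₃₀ b₃₁ b₃₂
  contracted-block = contract (nth labels c)
    (r₁₄ ∷ r₄ ∷ r₈ ∷ r₁₁ ∷ r₂ ∷ r₀ ∷ r₇ ∷ r₁ ∷ r₁₃ ∷ r₁₀ ∷ r₁₂ ∷ r₅ ∷ r₃ ∷ r₆ ∷ r₉ ∷ [])
  a₁ = proj₁ contracted-block
  a₂ = proj₁ (proj₂ contracted-block)
  b₁ = proj₁ (proj₂ (proj₂ contracted-block))
  s₀ = proj₁ (proj₂ (proj₂ (proj₂ contracted-block)))
  s₁ = proj₁ (proj₂ (proj₂ (proj₂ (proj₂ contracted-block))))
  s₂ = proj₂ (proj₂ (proj₂ (proj₂ (proj₂ contracted-block))))

unrealisable : ∀ {L : Set} n → ¬ Realisation n L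
unrealisable zero    = petersen-unrealisable
unrealisable (suc n) = unrealisable n ∘ contract-layer n

-- 2-colourings with at most two changes along each cycle

bit : Bool → ℕ
bit false = 0
bit true  = 1

flip? : Bool → Bool → ℕ
flip? a b = bit (a xor b)

changes : (ℕ → Bool) → ℕ → ℕ
changes p zero    = 0
changes p (suc n) = flip? (p 0) (p 1) + changes (p ∘ suc) n

changesFrom : Bool → List Bool → ℕ
changesFrom a []       = 0
changesFrom a (b ∷ bs) = flip? a b + changesFrom b bs

lastFrom : Bool → List Bool → Bool
lastFrom a []       = a
lastFrom a (b ∷ bs) = lastFrom b bs

changesAround : List Bool → ℕ
changesAround []       = 0
changesAround (b ∷ bs) = changesFrom (lastFrom b bs) (b ∷ bs)

cap : ℕ → ℕ
cap 0 = 0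
cap 1 = 1
cap (suc (suc _)) = 2

-- Cutting off at every step keeps the automaton finite; in the end only 0, 1 and more than 1 have
-- to be told apart.
count : (ℕ → Bool) → ℕ → ℕ
count p zero    = 0
count p (suc n) = cap (bit (p 0) + count (p ∘ suc) n)

changes-drop : ∀ (p : ℕ → Bool) k n → changes (p ∘ (k +_)) n ≤ changes p (k + n)
changes-drop p zero    n = ℕ.≤-refl
changes-drop p (suc k) n = ℕ.≤-trans (changes-drop (p ∘ suc) k n) (ℕ.m≤n+m _ _)

changesFrom-++ : ∀ a xs ys →
  changesFrom a (xs ++ ys) ≡ changesFrom a xs + changesFrom (lastFrom a xs) ys
changesFrom-++ a []       ys = refl
changesFrom-++ a (x ∷ xs) ys =
  trans (cong (flip? a x +_) (changesFrom-++ x xs ys)) (sym (ℕ.+-assoc (flip? a x) _ _))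

lastFrom-++ : ∀ a xs ys → lastFrom a (xs ++ ys) ≡ lastFrom (lastFrom a xs) ys
lastFrom-++ a []       ys = refl
lastFrom-++ a (x ∷ xs) ys = lastFrom-++ x xs ys

changesFrom-suffix : ∀ a xs y ys → changesFrom y ys ≤ changesFrom a (xs ++ y ∷ ys)
changesFrom-suffix a []       y ys = ℕ.m≤n+m _ _
changesFrom-suffix a (x ∷ xs) y ys = ℕ.≤-trans (changesFrom-suffix x xs y ys) (ℕ.m≤n+m _ _)

-- The colours of the first and last number, of the marker and of the two ends of the arc; the number
-- of changes along C and along the arc; the number of true and of false colours, cut off at 2.
State : Set
State = Bool × Bool × Bool × Bool × Bool × ℕ × ℕ × ℕ × ℕ

_≟ₛ_ : DecidableEquality State
_≟ₛ_ = ≡-dec Bool._≟_ (≡-dec Bool._≟_ (≡-dec Bool._≟_ (≡-dec Bool._≟_ (≡-dec Bool._≟_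
      (≡-dec ℕ._≟_ (≡-dec ℕ._≟_ (≡-dec ℕ._≟_ ℕ._≟_)))))))

open import Data.List.Membership.DecPropositional _≟ₛ_ using () renaming (_∈?_ to _∈ₛ?_)

module _ (n : ℕ) (p : ℕ → Bool) where

  arcStart arcEnd : Bool
  arcStart = p (arc-head n)
  arcEnd = lastFrom arcStart (map p (arc-tail n))

  outerChanges arcChanges : ℕ
  outerChanges = changes p (1 + n * 12)
  arcChanges   = changesFrom arcStart (map p (arc-tail n))

  outer : State
  outer = p 0 , p (1 + n * 12) , p (marker n) , arcStart , arcEnd , outerChanges , arcChanges ,
          count p (2 + n * 12) , count (not ∘ p) (2 + n * 12)

tally : ∀ {n} → (Bool → Bool) → Vec Bool n → ℕ → ℕ
tally f []       k = k
tally f (b ∷ bs) k = cap (bit (f b) + tally f bs k)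

-- The new numbers precede the old ones on C and enclose the old marker and arc on D, except 4, the
-- new marker. The sums are bracketed as `changes` and `changesFrom` unfold, down to the final
-- `+ 0`, so that `outer-suc` ends in `refl`.
layer : State → Vec Bool 12 → State
layer (first , last , mark , head , end , c , d , t , f)
      w@(w₀ ∷ w₁ ∷ w₂ ∷ w₃ ∷ w₄ ∷ w₅ ∷ w₆ ∷ w₇ ∷ w₈ ∷ w₉ ∷ w₁₀ ∷ w₁₁ ∷ []) =
  w₀ , last , w₄ , w₁₀ , w₈ ,
  flip? w₀ w₁ + (flip? w₁ w₂ + (flip? w₂ w₃ + (flip? w₃ w₄ + (flip? w₄ w₅ + (flip? w₅ w₆ +
    (flip? w₆ w₇ + (flip? w₇ w₈ + (flip? w₈ w₉ + (flip? w₉ w₁₀ + (flip? w₁₀ w₁₁ +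
    (flip? w₁₁ first + c))))))))))) ,
  flip? w₁₀ w₇ + (flip? w₇ w₉ + (flip? w₉ w₂ + (flip? w₂ w₀ + (flip? w₀ w₃ + (flip? w₃ mark +
    (flip? mark w₆ + (flip? w₆ head + (d +
    (flip? end w₁₁ + (flip? w₁₁ w₁ + (flip? w₁ w₅ + (flip? w₅ w₈ + 0)))))))))))) ,
  tally id w t , tally not w f

bits : (ℕ → Bool) → Vec Bool 12
bits p = p 0 ∷ p 1 ∷ p 2 ∷ p 3 ∷ p 4 ∷ p 5 ∷ p 6 ∷ p 7 ∷ p 8 ∷ p 9 ∷ p 10 ∷ p 11 ∷ []

module _ (n : ℕ) (p : ℕ → Bool) where

  private
    q : ℕ → Bool
    q = p ∘ (12 +_)
    ys : List ℕ
    ys = 11 ∷ 1 ∷ 5 ∷ 8 ∷ []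

  map-arc : map p (map (12 +_) (arc n) ++ ys) ≡ map q (arc n) ++ map p ys
  map-arc = trans (map-++ p (map (12 +_) (arc n)) ys)
                  (cong (_++ map p ys) (sym (map-∘ (arc n))))

  arcEnd-suc : arcEnd (suc n) p ≡ p 8
  arcEnd-suc = trans (cong (lastFrom (p 6)) map-arc) (lastFrom-++ (p 6) (map q (arc n)) (map p ys))

  arc-inner : changesFrom (p 6) (map p (map (12 +_) (arc n) ++ ys)) ≡
              flip? (p 6) (arcStart n q) + (arcChanges n q + changesFrom (arcEnd n q) (map p ys))
  arc-inner = trans (cong (changesFrom (p 6)) map-arc)
                    (cong (flip? (p 6) (arcStart n q) +_)
                          (changesFrom-++ (arcStart n q) (map q (arc-tail n)) (map p ys)))

  outer-suc : outer (suc n) p ≡ layer (outer n q) (bits p)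
  outer-suc rewrite arcEnd-suc | arc-inner = refl

  outerChanges-mono : outerChanges n q ≤ outerChanges (suc n) p
  outerChanges-mono = changes-drop p 12 (1 + n * 12)

  arcChanges-mono : arcChanges n q ≤ arcChanges (suc n) p
  arcChanges-mono = ℕ.≤-trans
    (ℕ.≤-trans (ℕ.m≤m+n _ _)
      (ℕ.≤-trans (ℕ.m≤n+m _ (flip? (p 6) (arcStart n q))) (ℕ.≤-reflexive (sym arc-inner))))
    (changesFrom-suffix (p 10)
      (p 7 ∷ p 9 ∷ p 2 ∷ p 0 ∷ p 3 ∷ p (12 + marker n) ∷ []) (p 6)
      (map p (map (12 +_) (arc n) ++ ys)))

pattern ○ = false
pattern ● = true

-- The closure under `layer` of the states at n = 0, without those that have more than two changes.
reachable : List State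
reachable =
  (○ , ○ , ○ , ○ , ○ , 0 , 0 , 0 , 2) ∷
  (○ , ○ , ○ , ○ , ○ , 2 , 2 , 1 , 2) ∷
  (○ , ○ , ○ , ○ , ● , 2 , 1 , 1 , 2) ∷
  (○ , ○ , ○ , ● , ○ , 2 , 1 , 1 , 2) ∷
  (○ , ○ , ○ , ● , ● , 2 , 2 , 2 , 2) ∷
  (○ , ○ , ● , ○ , ○ , 2 , 0 , 1 , 2) ∷
  (○ , ○ , ● , ○ , ○ , 2 , 2 , 2 , 2) ∷
  (○ , ● , ○ , ○ , ○ , 1 , 2 , 1 , 2) ∷
  (○ , ● , ○ , ● , ● , 1 , 0 , 1 , 1) ∷
  (○ , ● , ● , ● , ● , 1 , 2 , 2 , 1) ∷
  (● , ○ , ○ , ○ , ○ , 1 , 2 , 1 , 2) ∷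
  (● , ○ , ● , ○ , ○ , 1 , 0 , 1 , 1) ∷
  (● , ○ , ● , ● , ● , 1 , 2 , 2 , 1) ∷
  (● , ● , ○ , ● , ● , 2 , 0 , 2 , 1) ∷
  (● , ● , ○ , ● , ● , 2 , 2 , 2 , 2) ∷
  (● , ● , ● , ○ , ○ , 2 , 2 , 2 , 2) ∷
  (● , ● , ● , ○ , ● , 2 , 1 , 2 , 1) ∷
  (● , ● , ● , ● , ○ , 2 , 1 , 2 , 1) ∷
  (● , ● , ● , ● , ● , 0 , 0 , 2 , 0) ∷
  (● , ● , ● , ● , ● , 2 , 2 , 2 , 1) ∷
  []

fits : State → Bool
fits (_ , _ , _ , _ , _ , c , d , _) = (c ≤ᵇ 2) ∧ (d ≤ᵇ 2)

known : State → Bool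
known s = not (fits s) ∨ does (s ∈ₛ? reachable)

every : ∀ n → (Vec Bool n → Bool) → Bool
every zero    f = f []
every (suc n) f = every n (f ∘ (false ∷_)) ∧ every n (f ∘ (true ∷_))

every-sound : ∀ {n} f → T (every n f) → ∀ w → T (f w)
every-sound f ok []      = ok
every-sound f ok (b ∷ w) with Equivalence.to (T-∧ {every _ (f ∘ (false ∷_))}) ok
every-sound f ok (false ∷ w) | u , _ = every-sound (f ∘ (false ∷_)) u w
every-sound f ok (true  ∷ w) | _ , v = every-sound (f ∘ (true ∷_)) v w

modusPonens : ∀ a {b} → T a → T (not a ∨ b) → T b
modusPonens true _ h = h

does⇒ : ∀ {A : Set} (d : Dec A) → does d ≡ true → A
does⇒ (yes a) _ = a

known-sound : ∀ s → T (fits s) → T (known s) → s List.∈ reachable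
known-sound s fit ok = does⇒ (s ∈ₛ? reachable) (Equivalence.to Bool.T-≡ (modusPonens (fits s) fit ok))

-- Decided by evaluation over all listed states and all 4096 colourings of a layer. This certifies
-- that the list `reachable` is closed.
layer-known : ∀ {s} → s List.∈ reachable → ∀ w → T (known (layer s w))
layer-known s∈ =
  every-sound _ (All.lookup (All.all⁺ (λ s → every 12 (known ∘ layer s)) reachable _) s∈)

outer-reachable : ∀ n p → outerChanges n p ≤ 2 → arcChanges n p ≤ 2 → outer n p List.∈ reachable
outer-reachable n p c≤2 d≤2 =
  known-sound _ (Equivalence.from T-∧ (ℕ.≤⇒≤ᵇ c≤2 , ℕ.≤⇒≤ᵇ d≤2)) (go n p c≤2 d≤2)
  where
  go : ∀ n p → outerChanges n p ≤ 2 → arcChanges n p ≤ 2 → T (known (outer n p))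
  -- At the innermost level there are two numbers: 0, which is the marker, and 1, which is the whole
  -- arc.
  go zero    p _ _ = every-sound {2} (λ { (a ∷ b ∷ []) → known (a , b , a , b , b , flip? a b + 0 , 0 ,
                       tally id (a ∷ b ∷ []) 0 , tally not (a ∷ b ∷ []) 0) }) _ (p 0 ∷ p 1 ∷ [])
  go (suc n) p c≤2 d≤2 = subst (T ∘ known) (sym (outer-suc n p))
    (layer-known (outer-reachable n _ (ℕ.≤-trans (outerChanges-mono n p) c≤2)
                                      (ℕ.≤-trans (arcChanges-mono n p) d≤2)) (bits p))

ringChanges : State → Bool → Bool → Bool → ℕ
ringChanges (first , last , mark , head , end , c , d , t , f) a₀ a₁ a₂ =
  flip? last a₀ + (flip? a₀ a₁ + (flip? a₁ a₂ + (flip? a₂ first + c)))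

wordChanges : State → Bool → Bool → Bool → ℕ
wordChanges (first , last , mark , head , end , c , d , t , f) a₀ a₁ a₂ =
  flip? end a₂ + (flip? a₂ a₀ + (flip? a₀ mark + (flip? mark a₁ + (flip? a₁ head + d))))

small : State → Vec Bool 3 → Bool
small (first , last , mark , head , end , c , d , t , f) w = (tally id w t ≤ᵇ 1) ∨ (tally not w f ≤ᵇ 1)

closing : State → Vec Bool 3 → Bool
closing s w@(a₀ ∷ a₁ ∷ a₂ ∷ []) =
  not ((ringChanges s a₀ a₁ a₂ ≤ᵇ 2) ∧ (wordChanges s a₀ a₁ a₂ ≤ᵇ 2)) ∨ small s w

-- The numbers 0, 1, 2 close both cycles around the part summarised by a state. As that state is in
-- `reachable`, `closing` leaves finitely many cases, which are evaluated.
few : ∀ n p →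
  flip? (p (4 + n * 12)) (p 0) + changes p (4 + n * 12) ≤ 2 →
  changesAround (map p (word n)) ≤ 2 →
  count p (len n) ≤ 1 ⊎ count (not ∘ p) (len n) ≤ 1
few n p ring word≤ = conclude
  where
  q : ℕ → Bool
  q = p ∘ (3 +_)
  arc-eq : map p (map (3 +_) (arc-tail n)) ≡ map q (arc-tail n)
  arc-eq = sym (map-∘ (arc-tail n))
  word≤′ : wordChanges (outer n q) (p 0) (p 1) (p 2) ≤ 2
  word≤′ = subst (λ bs → flip? (lastFrom (q (arc-head n)) bs) (p 2) +
                    (flip? (p 2) (p 0) + (flip? (p 0) (q (marker n)) + (flip? (q (marker n)) (p 1) +
                    (flip? (p 1) (q (arc-head n)) + changesFrom (q (arc-head n)) bs)))) ≤ 2)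
                 arc-eq word≤
  c≤2 : outerChanges n q ≤ 2
  c≤2 = ℕ.≤-trans (changes-drop p 3 (1 + n * 12))
                  (ℕ.m+n≤o⇒n≤o (flip? (p (4 + n * 12)) (p 0)) ring)
  d≤2 : arcChanges n q ≤ 2
  d≤2 = ℕ.m+n≤o⇒n≤o (flip? (p 1) (arcStart n q)) (ℕ.m+n≤o⇒n≤o (flip? (q (marker n)) (p 1))
       (ℕ.m+n≤o⇒n≤o (flip? (p 0) (q (marker n))) (ℕ.m+n≤o⇒n≤o (flip? (p 2) (p 0))
       (ℕ.m+n≤o⇒n≤o (flip? (arcEnd n q) (p 2)) word≤′))))
  w : Vec Bool 3
  w = p 0 ∷ p 1 ∷ p 2 ∷ []
  ok : T (closing (outer n q) w)
  ok = every-sound (closing (outer n q))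
         (All.lookup (All.all⁺ (λ s → every 3 (closing s)) reachable _) (outer-reachable n q c≤2 d≤2)) w
  conclude : count p (len n) ≤ 1 ⊎ count (not ∘ p) (len n) ≤ 1
  conclude with Equivalence.to (T-∨ {count p (len n) ≤ᵇ 1})
                  (modusPonens _ (Equivalence.from T-∧ (ℕ.≤⇒≤ᵇ ring , ℕ.≤⇒≤ᵇ word≤′)) ok)
  ... | inj₁ h = inj₁ (ℕ.≤ᵇ⇒≤ _ _ h)
  ... | inj₂ h = inj₂ (ℕ.≤ᵇ⇒≤ _ _ h)

cap-bit : ∀ b m → b ≡ true → cap (bit b + m) ≤ 1 → m ≡ 0
cap-bit true zero    _ _ = refl
cap-bit true (suc m) _ (s≤s ())

cap-suc : ∀ b m → cap (bit b + m) ≤ 1 → m ≤ 1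
cap-suc false zero          _ = z≤n
cap-suc false (suc zero)    _ = s≤s z≤n
cap-suc false (suc (suc m)) (s≤s ())
cap-suc true  zero          _ = z≤n
cap-suc true  (suc m)       (s≤s ())

count-none : ∀ p n → count p n ≡ 0 → ∀ i → i < n → p i ≡ false
count-none p (suc n) c≡0 zero    _         with p 0
... | false = refl
... | true  = contradiction c≡0 (cap-suc≢0 _)
  where
  cap-suc≢0 : ∀ m → cap (suc m) ≢ 0
  cap-suc≢0 zero    ()
  cap-suc≢0 (suc m) ()
count-none p (suc n) c≡0 (suc i) (s≤s i<n) = count-none (p ∘ suc) n (rest (bit (p 0)) _ c≡0) i i<n
  where
  rest : ∀ a m → cap (a + m) ≡ 0 → m ≡ 0
  rest zero          zero          _ = refl
  rest zero          (suc zero)    ()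
  rest zero          (suc (suc m)) ()
  rest (suc zero)    zero          ()
  rest (suc zero)    (suc m)       ()
  rest (suc (suc a)) m             ()

count-unique : ∀ p n → count p n ≤ 1 → ∀ i j → i < n → j < n → p i ≡ true → p j ≡ true → i ≡ j
count-unique p (suc n) c zero    zero    _         _         _  _  = refl
count-unique p (suc n) c zero    (suc j) _         (s≤s j<n) pi pj =
  contradiction (trans (sym pj) (count-none (p ∘ suc) n (cap-bit (p 0) _ pi c) j j<n)) λ ()
count-unique p (suc n) c (suc i) zero    (s≤s i<n) _         pi pj =
  contradiction (trans (sym pi) (count-none (p ∘ suc) n (cap-bit (p 0) _ pj c) i i<n)) λ ()
count-unique p (suc n) c (suc i) (suc j) (s≤s i<n) (s≤s j<n) pi pj =
  cong suc (count-unique (p ∘ suc) n (cap-suc (p 0) _ c) i j i<n j<n pi pj)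

-- Cyclic order on Fin and cardinalities of subsets

module _ {m : ℕ} where

  prev : Fin (suc m) → Fin (suc m)
  prev zero    = fromℕ m
  prev (suc i) = inject₁ i

  next : Fin (suc m) → Fin (suc m)
  next i with view i
  ... | ‵fromℕ     = zero
  ... | ‵inject₁ j = suc j

  next-prev : ∀ i → next (prev i) ≡ i
  next-prev zero    rewrite view-fromℕ m   = refl
  next-prev (suc i) rewrite view-inject₁ i = refl

  prev-next : ∀ i → prev (next i) ≡ i
  prev-next i with view i
  ... | ‵fromℕ     = refl
  ... | ‵inject₁ j = refl

  prev-injective : ∀ {i j} → prev i ≡ prev j → i ≡ j
  prev-injective {i} {j} eq = trans (sym (next-prev i)) (trans (cong next eq) (next-prev j))

  next-injective : ∀ {i j} → next i ≡ next j → i ≡ j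
  next-injective {i} {j} eq = trans (sym (prev-next i)) (trans (cong prev eq) (prev-next j))

  -- Going back from `a` leads to `zero`, across the wraparound to the last index, and from there to
  -- every index.
  prev-closed : ∀ {S : Fin (suc m) → Set} → (∀ i → S i → S (prev i)) → ∀ {a} → S a → ∀ i → S i
  prev-closed {S} closed {a} Sa =
    >-weakInduction S (closed zero (<-weakInduction (λ i → S i → S zero) id (λ i f → f ∘ closed (suc i)) a Sa))
                      (λ i → closed (suc i))

  module _ (R : Fin (suc m) → Fin (suc m) → Set) (R-sym : ∀ {i j} → R i j → R j i) where

    cycle-connected : (∀ i → R (prev i) i) → ∀ i j → Star R i j
    cycle-connected step i j = toZero i ◅◅ reverse R-sym (toZero j)
      where
      toZero : ∀ i → Star R i zero
      toZero = <-weakInduction _ ε (λ i path → R-sym (step (suc i)) ◅ path)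

    path-connected : ∀ a → (∀ i → prev i ≢ a → i ≢ a → R (prev i) i) →
                     ∀ i j → i ≢ a → j ≢ a → Star R i j
    path-connected a step i j i≢a j≢a =
      let r , to = root a step in to i i≢a ◅◅ reverse R-sym (to j j≢a)
      where
      root : ∀ a → (∀ i → prev i ≢ a → i ≢ a → R (prev i) i) →
             ∃[ r ] (∀ i → i ≢ a → Star R i r)
      -- Without `zero` the cycle is a path that climbs to the last index and never wraps around.
      root zero    step = fromℕ m , >-weakInduction _ (λ _ → ε)
        (λ i path i≢0 → step (suc i) i≢0 (λ ()) ◅ path (λ ()))
      -- Indices below `a` descend to `zero`; those above `a` climb to the last index and reach
      -- `zero` across the wraparound.
      root (suc b) step = zero , to
        where
        below : ∀ i → toℕ i < suc (toℕ b) → Star R i zero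
        below = <-weakInduction _ (λ _ → ε) λ i path i<a →
          let i<a′ = ℕ.≤-trans (s≤s (ℕ.≤-reflexive (toℕ-inject₁ i))) (ℕ.≤-trans (ℕ.n≤1+n _) i<a)
          in R-sym (step (suc i) (λ eq → ℕ.<-irrefl (cong toℕ eq) i<a′) (λ eq → ℕ.<-irrefl (cong toℕ eq) i<a))
             ◅ path i<a′
        above : ∀ i → suc (toℕ b) < toℕ i → Star R i zero
        above = >-weakInduction _
          (λ a<i → step zero (λ eq → ℕ.<-irrefl (cong toℕ (sym eq)) a<i) (λ ()) ◅ ε)
          λ i path a<i →
            let a<i′ = ℕ.≤-trans a<i (ℕ.≤-trans (ℕ.≤-reflexive (toℕ-inject₁ i)) (ℕ.n≤1+n _))
            in step (suc i) (λ eq → ℕ.<-irrefl (cong toℕ (sym eq)) a<i) (λ eq → ℕ.<-irrefl (cong toℕ (sym eq)) a<i′)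
               ◅ path a<i′
        to : ∀ i → i ≢ suc b → Star R i zero
        to i i≢a with ℕ.<-cmp (toℕ i) (suc (toℕ b))
        ... | tri< i<a _ _ = below i i<a
        ... | tri≈ _ i≡a _ = contradiction (Fin.toℕ-injective i≡a) i≢a
        ... | tri> _ _ a<i = above i a<i

prev≢ : ∀ {m} (i : Fin (2 + m)) → prev i ≢ i
prev≢ (suc i) eq = ℕ.<-irrefl (trans (sym (toℕ-inject₁ i)) (cong toℕ eq)) (ℕ.n<1+n _)

prev²≢ : ∀ {m} (i : Fin (3 + m)) → prev (prev i) ≢ i
prev²≢ (suc (suc i)) eq =
  ℕ.<-irrefl (trans (sym (trans (toℕ-inject₁ (inject₁ i)) (toℕ-inject₁ i))) (cong toℕ eq)) (s≤s (ℕ.n≤1+n _))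

prev³≢ : ∀ {m} (i : Fin (4 + m)) → prev (prev (prev i)) ≢ i
prev³≢ (suc (suc (suc i))) eq =
  ℕ.<-irrefl (trans (sym (trans (toℕ-inject₁ (inject₁ (inject₁ i))) (trans (toℕ-inject₁ (inject₁ i)) (toℕ-inject₁ i))))
                    (cong toℕ eq)) (s≤s (ℕ.m≤n⇒m≤1+n (ℕ.n≤1+n _)))

module _ {n : ℕ} where

  ∈-tabulate⁺ : ∀ (f : Fin n → Bool) {x} → f x ≡ true → x ∈ tabulate f
  ∈-tabulate⁺ f {x} eq = lookup⇒[]= x (tabulate f) (trans (lookup∘tabulate f x) eq)

  ∈-tabulate⁻ : ∀ (f : Fin n → Bool) {x} → x ∈ tabulate f → f x ≡ true
  ∈-tabulate⁻ f {x} x∈ = trans (sym (lookup∘tabulate f x)) ([]=⇒lookup x∈)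

─-∉ : ∀ {n} (p q : Subset n) {x} → x ∈ p ─ q → x ∉ q
─-∉ (true  ∷ p) (false ∷ q) here         ()
─-∉ (_     ∷ p) (_     ∷ q) (there x∈) (there x∈q) = ─-∉ p q x∈ x∈q

∣p∣≤1+∣p-x∣ : ∀ {n} (p : Subset n) x → ∣ p ∣ ≤ suc ∣ p - x ∣
∣p∣≤1+∣p-x∣ (false ∷ p) zero    = ℕ.m≤n⇒m≤1+n (ℕ.≤-reflexive (cong ∣_∣ (sym (p─⊥≡p p))))
∣p∣≤1+∣p-x∣ (true  ∷ p) zero    = s≤s (ℕ.≤-reflexive (cong ∣_∣ (sym (p─⊥≡p p))))
∣p∣≤1+∣p-x∣ (false ∷ p) (suc x) = ∣p∣≤1+∣p-x∣ p x
∣p∣≤1+∣p-x∣ (true  ∷ p) (suc x) = s≤s (∣p∣≤1+∣p-x∣ p x)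

card≤ : ∀ {n} (s : Subset n) (xs : List (Fin n)) → (∀ {x} → x ∈ s → x List.∈ xs) → ∣ s ∣ ≤ length xs
card≤ {n} s [] s⊆ = ℕ.≤-reflexive (trans (cong ∣_∣ (Empty-unique empty)) (∣⊥∣≡0 n))
  where
  empty : Empty s
  empty (x , x∈) with () ← s⊆ x∈
card≤ s (x ∷ xs) s⊆ = ℕ.≤-trans (∣p∣≤1+∣p-x∣ s x) (s≤s (card≤ (s - x) xs rest))
  where
  rest : ∀ {y} → y ∈ s - x → y List.∈ xs
  rest y∈ with s⊆ (p─q⊆p s ⁅ x ⁆ y∈)
  ... | here refl = contradiction (x∈⁅x⁆ x) (─-∉ s ⁅ x ⁆ y∈)
  ... | there y∈′ = y∈′

card≥ : ∀ {n} (s : Subset n) {xs : List (Fin n)} → Unique xs → All (_∈ s) xs → length xs ≤ ∣ s ∣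
card≥ s []             []        = z≤n
card≥ s (x≢ ∷ unique) (x∈ ∷ xs∈) = ℕ.≤-trans (s≤s (card≥ (s - _) unique rest)) (x∈p⇒∣p-x∣<∣p∣ x∈)
  where
  rest = All.zipWith (λ (x≢y , y∈) → x∈p∧x≢y⇒x∈p-y y∈ (≢-sym x≢y)) (x≢ , xs∈)

card≡ : ∀ {n} (s : Subset n) {xs : List (Fin n)} → Unique xs → All (_∈ s) xs →
        (∀ {x} → x ∈ s → x List.∈ xs) → ∣ s ∣ ≡ length xs
card≡ s unique xs⊆ s⊆ = ℕ.≤-antisym (card≤ s _ s⊆) (card≥ s unique xs⊆)

pullback : ∀ {m n} → (Fin m → Fin n) → Subset n → Subset m
pullback f s = tabulate (lookup s ∘ f)

∈-pullback : ∀ {m n} (f : Fin m → Fin n) s {x} → f x ∈ s → x ∈ pullback f s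
∈-pullback f s fx∈ = ∈-tabulate⁺ (lookup s ∘ f) ([]=⇒lookup fx∈)

card-split : ∀ m {n} (s : Subset (m + n)) → ∣ s ∣ ≡ ∣ pullback (_↑ˡ n) s ∣ + ∣ pullback (m ↑ʳ_) s ∣
card-split zero    s = cong ∣_∣ (sym (tabulate∘lookup s))
card-split (suc m) (false ∷ s) = card-split m s
card-split (suc m) (true  ∷ s) = cong suc (card-split m s)

-- The graph of a permutation

xor≡true⁻ : ∀ {a b} → a xor b ≡ true → a ≢ b
xor≡true⁻ {true}  eq refl with () ← eq
xor≡true⁻ {false} eq refl with () ← eq

samePair-join : ∀ {L : Set} {a b c d x y : L} → SamePair a b x y → SamePair c d x y → SamePair a b c d
samePair-join (inj₁ (refl , refl)) (inj₁ (refl , refl)) = inj₁ (refl , refl)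
samePair-join (inj₁ (refl , refl)) (inj₂ (refl , refl)) = inj₂ (refl , refl)
samePair-join (inj₂ (refl , refl)) (inj₁ (refl , refl)) = inj₂ (refl , refl)
samePair-join (inj₂ (refl , refl)) (inj₂ (refl , refl)) = inj₁ (refl , refl)

samePair-≢ : ∀ {L : Set} {a b x y : L} → x ≢ y → SamePair a b x y → a ≢ b
samePair-≢ x≢y (inj₁ (refl , refl)) = x≢y
samePair-≢ x≢y (inj₂ (refl , refl)) = ≢-sym x≢y

pair-partner : ∀ {A : Set} {xs : List A} {y} → Unique xs → length xs ≡ 2 → y List.∈ xs →
               ∃[ z ] z List.∈ xs × z ≢ y × (∀ {w} → w List.∈ xs → w ≡ y ⊎ w ≡ z)
pair-partner {xs = a ∷ b ∷ []} ((a≢b ∷ []) ∷ _) _ (here refl) =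
  b , there (here refl) , ≢-sym a≢b , λ { (here eq) → inj₁ eq ; (there (here eq)) → inj₂ eq }
pair-partner {xs = a ∷ b ∷ []} ((a≢b ∷ []) ∷ _) _ (there (here refl)) =
  a , here refl , a≢b , λ { (here eq) → inj₂ eq ; (there (here eq)) → inj₁ eq }

pair-elements : ∀ {A : Set} {xs : List A} → Unique xs → length xs ≡ 2 →
                ∃[ x ] ∃[ y ] x List.∈ xs × y List.∈ xs × x ≢ y
pair-elements {xs = x ∷ y ∷ []} ((x≢y ∷ []) ∷ _) _ = x , y , here refl , there (here refl) , x≢y

-- Both pairs exhaust the two colours other than `x`. All choices are tried.
three-colours : ∀ (a b x c d : Fin 3) → a ≢ b → a ≢ x → b ≢ x → c ≢ d → c ≢ x → d ≢ x → SamePair a b c d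
three-colours = toWitness {a? = all? λ a → all? λ b → all? λ x → all? λ c → all? λ d →
  ¬? (a Fin.≟ b) →-dec ¬? (a Fin.≟ x) →-dec ¬? (b Fin.≟ x) →-dec
  ¬? (c Fin.≟ d) →-dec ¬? (c Fin.≟ x) →-dec ¬? (d Fin.≟ x) →-dec
  (((a Fin.≟ c) ×-dec (b Fin.≟ d)) ⊎-dec ((a Fin.≟ d) ×-dec (b Fin.≟ c)))} _

module CyclePermutation (m : ℕ) (π σ : Fin (5 + m) → Fin (5 + m))
                        (σ-π : ∀ i → σ (π i) ≡ i) (π-σ : ∀ j → π (σ j) ≡ j) where

  k : ℕ
  k = 5 + m

  -- C and D are the cycles `true` and `false`. The rim edge i joins the vertices prev i and i of its
  -- cycle, the rung i joins vertex i of C to vertex π i of D, and the vertex i of cycle s is on the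
  -- rung spoke s i.
  vertex : Bool → Fin k → Fin (k + k)
  vertex true  i = i ↑ˡ k
  vertex false j = k ↑ʳ j

  rim : Bool → Fin k → Fin (k + (k + k))
  rim true  i = i ↑ˡ (k + k)
  rim false j = k ↑ʳ (j ↑ˡ k)

  rung : Fin k → Fin (k + (k + k))
  rung i = k ↑ʳ (k ↑ʳ i)

  spoke : Bool → Fin k → Fin k
  spoke true  i = i
  spoke false j = σ j

  spoke-injective : ∀ s {i j} → spoke s i ≡ spoke s j → i ≡ j
  spoke-injective true  eq = eq
  spoke-injective false {i} {j} eq = trans (sym (π-σ i)) (trans (cong π eq) (π-σ j))

  vertexAt : Fin (k + k) → Bool × Fin k
  vertexAt v = [ true ,_ , false ,_ ]′ (splitAt k v)

  edgeAt : Fin (k + (k + k)) → Bool × Fin k ⊎ Fin k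
  edgeAt e = [ (λ i → inj₁ (true , i)) , (λ f → [ (λ j → inj₁ (false , j)) , inj₂ ]′ (splitAt k f)) ]′
               (splitAt k e)

  vertexAt-vertex : ∀ s i → vertexAt (vertex s i) ≡ (s , i)
  vertexAt-vertex true  i rewrite splitAt-↑ˡ k i k = refl
  vertexAt-vertex false i rewrite splitAt-↑ʳ k k i = refl

  edgeAt-rim : ∀ s i → edgeAt (rim s i) ≡ inj₁ (s , i)
  edgeAt-rim true  i rewrite splitAt-↑ˡ k i (k + k) = refl
  edgeAt-rim false i rewrite splitAt-↑ʳ k (k + k) (i ↑ˡ k) | splitAt-↑ˡ k i k = refl

  edgeAt-rung : ∀ i → edgeAt (rung i) ≡ inj₂ i
  edgeAt-rung i rewrite splitAt-↑ʳ k (k + k) (k ↑ʳ i) | splitAt-↑ʳ k k i = refl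

  data VertexView : Fin (k + k) → Set where
    isVertex : ∀ s i → VertexView (vertex s i)

  vertexView : ∀ v → VertexView v
  vertexView v = subst VertexView (join-splitAt k k v) (go (splitAt k v))
    where
    go : ∀ x → VertexView (join k k x)
    go (inj₁ i) = isVertex true i
    go (inj₂ j) = isVertex false j

  data EdgeView : Fin (k + (k + k)) → Set where
    isRim  : ∀ s i → EdgeView (rim s i)
    isRung : ∀ i → EdgeView (rung i)

  edgeView : ∀ e → EdgeView e
  edgeView e = subst EdgeView (join-splitAt k (k + k) e) (go (splitAt k e))
    where
    go′ : ∀ x → EdgeView (k ↑ʳ join k k x)
    go′ (inj₁ j) = isRim false j
    go′ (inj₂ i) = isRung i
    go : ∀ x → EdgeView (join k (k + k) x)
    go (inj₁ i) = isRim true i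
    go (inj₂ f) = subst (EdgeView ∘ (k ↑ʳ_)) (join-splitAt k k f) (go′ (splitAt k f))

  vertex-injective : ∀ s t {i j} → vertex s i ≡ vertex t j → s ≡ t × i ≡ j
  vertex-injective s t {i} {j} eq
    with refl ← trans (sym (vertexAt-vertex s i)) (trans (cong vertexAt eq) (vertexAt-vertex t j)) = refl , refl

  rim-injective : ∀ s t {i j} → rim s i ≡ rim t j → s ≡ t × i ≡ j
  rim-injective s t {i} {j} eq
    with refl ← trans (sym (edgeAt-rim s i)) (trans (cong edgeAt eq) (edgeAt-rim t j)) = refl , refl

  rung-injective : ∀ {i j} → rung i ≡ rung j → i ≡ j
  rung-injective {i} {j} eq
    with refl ← trans (sym (edgeAt-rung i)) (trans (cong edgeAt eq) (edgeAt-rung j)) = refl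

  rim≢rung : ∀ s i {j} → rim s i ≢ rung j
  rim≢rung s i {j} eq
    with () ← trans (sym (edgeAt-rim s i)) (trans (cong edgeAt eq) (edgeAt-rung j))

  endsOf : Bool × Fin k ⊎ Fin k → Fin (k + k) × Fin (k + k)
  endsOf (inj₁ (s , i)) = vertex s (prev i) , vertex s i
  endsOf (inj₂ i)       = vertex true i , vertex false (π i)

  ends′ : Fin (k + (k + k)) → Fin (k + k) × Fin (k + k)
  ends′ e = endsOf (edgeAt e)

  ends-rim : ∀ s i → ends′ (rim s i) ≡ (vertex s (prev i) , vertex s i)
  ends-rim s i = cong endsOf (edgeAt-rim s i)

  ends-rung : ∀ i → ends′ (rung i) ≡ (vertex true i , vertex false (π i))
  ends-rung i = cong endsOf (edgeAt-rung i)

  Touches : Fin (k + k) → Fin (k + (k + k)) → Set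
  Touches v e = v ≡ proj₁ (ends′ e) ⊎ v ≡ proj₂ (ends′ e)

  touches-rim⁻ : ∀ s i t j → Touches (vertex s i) (rim t j) → s ≡ t × (i ≡ prev j ⊎ i ≡ j)
  touches-rim⁻ s i t j (inj₁ eq) = map₂ inj₁ (vertex-injective s t (trans eq (cong proj₁ (ends-rim t j))))
  touches-rim⁻ s i t j (inj₂ eq) = map₂ inj₂ (vertex-injective s t (trans eq (cong proj₂ (ends-rim t j))))

  touches-rung⁻ : ∀ s i j → Touches (vertex s i) (rung j) → j ≡ spoke s i
  touches-rung⁻ s i j (inj₁ eq) with vertex-injective s true (trans eq (cong proj₁ (ends-rung j)))
  ... | refl , refl = refl
  touches-rung⁻ s i j (inj₂ eq) with vertex-injective s false (trans eq (cong proj₂ (ends-rung j)))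
  ... | refl , refl = sym (σ-π j)

  touches-before : ∀ s i → Touches (vertex s i) (rim s i)
  touches-before s i = inj₂ (sym (cong proj₂ (ends-rim s i)))

  touches-prev : ∀ s i → Touches (vertex s (prev i)) (rim s i)
  touches-prev s i = inj₁ (sym (cong proj₁ (ends-rim s i)))

  touches-after : ∀ s i → Touches (vertex s i) (rim s (next i))
  touches-after s i = subst (λ j → Touches (vertex s j) (rim s (next i))) (prev-next i) (touches-prev s (next i))

  touches-spoke : ∀ s i → Touches (vertex s i) (rung (spoke s i))
  touches-spoke true  i = inj₁ (sym (cong proj₁ (ends-rung i)))
  touches-spoke false j = inj₂ (sym (trans (cong proj₂ (ends-rung (σ j))) (cong (vertex false) (π-σ j))))

  edges-at : ∀ s i {e} → Touches (vertex s i) e →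
             e List.∈ rim s i ∷ rim s (next i) ∷ rung (spoke s i) ∷ []
  edges-at s i {e} t with edgeView e
  ... | isRung j = there (there (here (cong rung (touches-rung⁻ s i j t))))
  ... | isRim t′ j with touches-rim⁻ s i t′ j t
  ... | refl , inj₁ refl = there (here (cong (rim s) (sym (next-prev j))))
  ... | refl , inj₂ refl = here refl

  next≢ : (i : Fin k) → next i ≢ i
  next≢ i eq = prev≢ i (trans (cong prev (sym eq)) (prev-next i))

  loopless′ : ∀ e → proj₁ (ends′ e) ≢ proj₂ (ends′ e)
  loopless′ e with edgeAt e
  ... | inj₁ (s , i) = prev≢ i ∘ proj₂ ∘ vertex-injective s s
  ... | inj₂ i       = (λ ()) ∘ proj₁ ∘ vertex-injective true false {i} {π i}

  noParallel′ : ∀ e f → (∀ v → Touches v e → Touches v f) → e ≡ f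
  noParallel′ e f sub with edgeView e | edgeView f
  ... | isRung i  | isRung j  = cong rung (sym (touches-rung⁻ true i j (sub _ (touches-spoke true i))))
  ... | isRung i  | isRim t j = contradiction
    (trans (proj₁ (touches-rim⁻ true i t j (sub _ (touches-spoke true i))))
           (sym (proj₁ (touches-rim⁻ false (π i) t j (sub _ (inj₂ (sym (cong proj₂ (ends-rung i))))))))) λ ()
  ... | isRim s i | isRung j  = contradiction
    (spoke-injective s (trans (sym (touches-rung⁻ s (prev i) j (sub _ (touches-prev s i))))
                              (touches-rung⁻ s i j (sub _ (touches-before s i)))))
    (prev≢ i)
  ... | isRim s i | isRim t j
    with touches-rim⁻ s i t j (sub _ (touches-before s i)) | touches-rim⁻ s (prev i) t j (sub _ (touches-prev s i))
  ... | refl , inj₂ refl | _               = refl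
  ... | refl , inj₁ _    | _ , inj₁ eq     = cong (rim s) (prev-injective eq)
  ... | refl , inj₁ refl | _ , inj₂ eq     = contradiction eq (prev²≢ j)

  G : Graph
  G = record
    { order = k + k ; size = k + (k + k) ; ends = ends′ ; loopless = loopless′ ; noParallel = noParallel′ }

  open Graph G using (edgesAt; incident?)
  open Part

  Sub : Set
  Sub = Part G

  ∈-edgesAt⁺ : ∀ {v e} → Touches v e → e ∈ edgesAt v
  ∈-edgesAt⁺ {v} {e} t = ∈-tabulate⁺ (λ e → does (incident? v e)) (dec-true (incident? v e) t)

  ∈-edgesAt⁻ : ∀ {v e} → e ∈ edgesAt v → Touches v e
  ∈-edgesAt⁻ {v} {e} e∈ = does⇒ (incident? v e) (∈-tabulate⁻ (λ e → does (incident? v e)) e∈)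

  three-distinct : ∀ s i → Unique (rim s i ∷ rim s (next i) ∷ rung (spoke s i) ∷ [])
  three-distinct s i =
    ((λ eq → next≢ i (sym (proj₂ (rim-injective s s eq)))) ∷ rim≢rung s i ∷ []) ∷ (rim≢rung s (next i) ∷ []) ∷ [] ∷ []

  cubic : Cubic G
  cubic v _ with vertexView v
  ... | isVertex s i = card≡ (edgesAt (vertex s i) ∩ ⊤) (three-distinct s i)
    (member (touches-before s i) ∷ member (touches-after s i) ∷ member (touches-spoke s i) ∷ [])
    (λ e∈ → edges-at s i (∈-edgesAt⁻ (proj₁ (x∈p∩q⁻ _ _ e∈))))
    where
    member : ∀ {e} → Touches (vertex s i) e → e ∈ edgesAt (vertex s i) ∩ ⊤
    member t = x∈p∩q⁺ (∈-edgesAt⁺ t , ∈⊤)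

  -- `pass` follows the rim through the vertex; `left` and `right` combine the rung with the rim
  -- edge before or after it.
  data TwoOfThree (H : Sub) (s : Bool) (i : Fin k) : Set where
    pass  : rim s i ∈ edges H → rim s (next i) ∈ edges H → rung (spoke s i) ∉ edges H → TwoOfThree H s i
    left  : rim s i ∈ edges H → rim s (next i) ∉ edges H → rung (spoke s i) ∈ edges H → TwoOfThree H s i
    right : rim s i ∉ edges H → rim s (next i) ∈ edges H → rung (spoke s i) ∈ edges H → TwoOfThree H s i

  twoOfThree : ∀ {H} → Regular G 2 H → ∀ s i → vertex s i ∈ verts H → TwoOfThree H s i
  twoOfThree {H} regular s i v∈ = go (e₁ ∈? edges H) (e₂ ∈? edges H) (e₃ ∈? edges H)
    where
    e₁ = rim s i
    e₂ = rim s (next i)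
    e₃ = rung (spoke s i)
    X = edgesAt (vertex s i) ∩ edges H
    X≡2 : ∣ X ∣ ≡ 2
    X≡2 = regular _ v∈
    X⊆ : ∀ {e} → e ∈ X → e List.∈ e₁ ∷ e₂ ∷ e₃ ∷ []
    X⊆ e∈ = edges-at s i (∈-edgesAt⁻ (proj₁ (x∈p∩q⁻ _ _ e∈)))
    X⊆H : ∀ {e} → e ∈ X → e ∈ edges H
    X⊆H e∈ = proj₂ (x∈p∩q⁻ _ _ e∈)
    atMostOne : ∀ e → (∀ {f} → f ∈ X → f ≡ e) → TwoOfThree H s i
    atMostOne e h =
      contradiction (ℕ.≤-trans (ℕ.≤-reflexive (sym X≡2)) (card≤ X (e ∷ []) (here ∘ h))) λ { (s≤s ()) }
    go : Dec (e₁ ∈ edges H) → Dec (e₂ ∈ edges H) → Dec (e₃ ∈ edges H) → TwoOfThree H s i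
    go (yes p) (yes q) (no ¬r) = pass p q ¬r
    go (yes p) (no ¬q) (yes r) = left p ¬q r
    go (no ¬p) (yes q) (yes r) = right ¬p q r
    go (yes p) (yes q) (yes r) = contradiction
      (ℕ.≤-trans (card≥ X (three-distinct s i)
        (x∈p∩q⁺ (∈-edgesAt⁺ (touches-before s i) , p) ∷ x∈p∩q⁺ (∈-edgesAt⁺ (touches-after s i) , q) ∷
         x∈p∩q⁺ (∈-edgesAt⁺ (touches-spoke s i) , r) ∷ [])) (ℕ.≤-reflexive X≡2)) λ { (s≤s (s≤s ())) }
    go (no ¬p) (no ¬q) _ = atMostOne e₃ λ f∈ → pick (X⊆ f∈) (X⊆H f∈)
      where
      pick : ∀ {f} → f List.∈ e₁ ∷ e₂ ∷ e₃ ∷ [] → f ∈ edges H → f ≡ e₃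
      pick (here refl)                 f∈ = contradiction f∈ ¬p
      pick (there (here refl))         f∈ = contradiction f∈ ¬q
      pick (there (there (here refl))) f∈ = refl
    go (no ¬p) (yes q) (no ¬r) = atMostOne e₂ λ f∈ → pick (X⊆ f∈) (X⊆H f∈)
      where
      pick : ∀ {f} → f List.∈ e₁ ∷ e₂ ∷ e₃ ∷ [] → f ∈ edges H → f ≡ e₂
      pick (here refl)                 f∈ = contradiction f∈ ¬p
      pick (there (here refl))         f∈ = refl
      pick (there (there (here refl))) f∈ = contradiction f∈ ¬r
    go (yes p) (no ¬q) (no ¬r) = atMostOne e₁ λ f∈ → pick (X⊆ f∈) (X⊆H f∈)
      where
      pick : ∀ {f} → f List.∈ e₁ ∷ e₂ ∷ e₃ ∷ [] → f ∈ edges H → f ≡ e₁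
      pick (here refl)                 f∈ = refl
      pick (there (here refl))         f∈ = contradiction f∈ ¬q
      pick (there (there (here refl))) f∈ = contradiction f∈ ¬r

  -- The two cycles and the permutation 2-factor

  onSide : Bool → Fin (k + k) → Bool
  onSide s v = does (proj₁ (vertexAt v) Bool.≟ s)

  onRimAt : Bool → Bool × Fin k ⊎ Fin k → Bool
  onRimAt s (inj₁ (t , _)) = does (t Bool.≟ s)
  onRimAt s (inj₂ _)       = false

  onRim : Bool → Fin (k + (k + k)) → Bool
  onRim s e = onRimAt s (edgeAt e)

  cycle : Bool → Sub
  cycle s = part (tabulate (onSide s)) (tabulate (onRim s))

  ∈-cycle⁺ : ∀ s i → vertex s i ∈ verts (cycle s)
  ∈-cycle⁺ s i = ∈-tabulate⁺ (onSide s)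
    (trans (cong (λ x → does (proj₁ x Bool.≟ s)) (vertexAt-vertex s i)) (dec-true (s Bool.≟ s) refl))

  ∈-cycle⁻ : ∀ s t i → vertex t i ∈ verts (cycle s) → t ≡ s
  ∈-cycle⁻ s t i v∈ = does⇒ (t Bool.≟ s)
    (trans (sym (cong (λ x → does (proj₁ x Bool.≟ s)) (vertexAt-vertex t i))) (∈-tabulate⁻ (onSide s) v∈))

  rim∈⁺ : ∀ s i → rim s i ∈ edges (cycle s)
  rim∈⁺ s i = ∈-tabulate⁺ (onRim s)
    (trans (cong (onRimAt s) (edgeAt-rim s i)) (dec-true (s Bool.≟ s) refl))

  rim∈⁻ : ∀ s t i → rim t i ∈ edges (cycle s) → t ≡ s
  rim∈⁻ s t i e∈ = does⇒ (t Bool.≟ s)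
    (trans (sym (cong (onRimAt s) (edgeAt-rim t i))) (∈-tabulate⁻ (onRim s) e∈))

  rung∉ : ∀ s i → rung i ∉ edges (cycle s)
  rung∉ s i e∈
    with () ← trans (sym (∈-tabulate⁻ (onRim s) e∈)) (cong (onRimAt s) (edgeAt-rung i))

  data RimOf (s : Bool) : Fin (k + (k + k)) → Set where
    rimOf : ∀ i → RimOf s (rim s i)

  rimView : ∀ s {e} → e ∈ edges (cycle s) → RimOf s e
  rimView s {e} e∈ with edgeView e
  ... | isRung i = contradiction e∈ (rung∉ s i)
  ... | isRim t i with refl ← rim∈⁻ s t i e∈ = rimOf i

  cycle-subgraph : ∀ s → IsSubgraph G (cycle s)
  cycle-subgraph s {v} e∈ t with rimView s e∈ | vertexView v
  ... | rimOf i | isVertex t′ j with refl ← proj₁ (touches-rim⁻ t′ j s i t) = ∈-cycle⁺ s j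

  cycle-regular : ∀ s → Regular G 2 (cycle s)
  cycle-regular s v v∈ with vertexView v
  ... | isVertex t i with refl ← ∈-cycle⁻ s t i v∈ =
    card≡ (edgesAt (vertex s i) ∩ edges (cycle s)) {rim s i ∷ rim s (next i) ∷ []}
      (((λ eq → next≢ i (sym (proj₂ (rim-injective s s eq)))) ∷ []) ∷ [] ∷ [])
      (x∈p∩q⁺ (∈-edgesAt⁺ (touches-before s i) , rim∈⁺ s i) ∷
       x∈p∩q⁺ (∈-edgesAt⁺ (touches-after s i) , rim∈⁺ s (next i)) ∷ [])
      λ e∈ → let at , rim∈ = x∈p∩q⁻ (edgesAt (vertex s i)) _ e∈
             in pick (edges-at s i (∈-edgesAt⁻ at)) rim∈
    where
    pick : ∀ {f} → f List.∈ rim s i ∷ rim s (next i) ∷ rung (spoke s i) ∷ [] → f ∈ edges (cycle s) →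
           f List.∈ rim s i ∷ rim s (next i) ∷ []
    pick (here eq)                 _  = here eq
    pick (there (here eq))         _  = there (here eq)
    pick (there (there (here refl))) f∈ = contradiction f∈ (rung∉ s (spoke s i))

  adjacent-sym : ∀ {H u v} → Adjacent G H u v → Adjacent G H v u
  adjacent-sym (e , e∈ , joins) = e , e∈ , swap joins

  cycle-connected′ : ∀ s → Connected G (cycle s)
  cycle-connected′ s = (_ , ∈-cycle⁺ s zero) , connect
    where
    connect : ∀ u v → u ∈ verts (cycle s) → v ∈ verts (cycle s) → Star (Adjacent G (cycle s)) u v
    connect u v u∈ v∈ with vertexView u | vertexView v
    ... | isVertex t i | isVertex t′ j with refl ← ∈-cycle⁻ s t i u∈ | refl ← ∈-cycle⁻ s t′ j v∈ =
      Star.gmap (vertex s) id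
        (cycle-connected (λ i j → Adjacent G (cycle s) (vertex s i) (vertex s j)) (adjacent-sym {cycle s})
          (λ i → rim s i , rim∈⁺ s i , inj₁ (ends-rim s i)) i j)

  cycle-deletion : ∀ s x → x ∈ verts (cycle s) → Connected G (deleteVertex G (cycle s) x)
  cycle-deletion s x x∈ with vertexView x
  ... | isVertex t a with refl ← ∈-cycle⁻ s t a x∈ = (_ , kept (next≢ a)) , connect
    where
    H = deleteVertex G (cycle s) (vertex s a)
    kept : ∀ {i} → i ≢ a → vertex s i ∈ verts H
    kept {i} i≢a = x∈p∧x≢y⇒x∈p-y (∈-cycle⁺ s i) (i≢a ∘ proj₂ ∘ vertex-injective s s)
    kept⁻ : ∀ t i → vertex t i ∈ verts H → t ≡ s × i ≢ a
    kept⁻ t i v∈ with refl ← ∈-cycle⁻ s t i (p─q⊆p (verts (cycle s)) ⁅ vertex s a ⁆ v∈) =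
      refl , λ { refl → ─-∉ (verts (cycle s)) ⁅ vertex s a ⁆ v∈ (x∈⁅x⁆ _) }
    step : ∀ i → prev i ≢ a → i ≢ a → Adjacent G H (vertex s (prev i)) (vertex s i)
    step i p≢a i≢a = rim s i , x∈p∧x∉q⇒x∈p─q (rim∈⁺ s i) avoids , inj₁ (ends-rim s i)
      where
      avoids : rim s i ∉ edgesAt (vertex s a)
      avoids e∈ with touches-rim⁻ s a s i (∈-edgesAt⁻ e∈)
      ... | _ , inj₁ eq = p≢a (sym eq)
      ... | _ , inj₂ eq = i≢a (sym eq)
    connect : ∀ u v → u ∈ verts H → v ∈ verts H → Star (Adjacent G H) u v
    connect u v u∈ v∈ with vertexView u | vertexView v
    ... | isVertex t i | isVertex t′ j with refl , i≢a ← kept⁻ t i u∈ | refl , j≢a ← kept⁻ t′ j v∈ =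
      Star.gmap (vertex s) id
        (path-connected (λ i j → Adjacent G H (vertex s i) (vertex s j)) (adjacent-sym {H}) a step i j i≢a j≢a)

  cycle-circuit : ∀ s → IsCircuit G (cycle s)
  cycle-circuit s = cycle-subgraph s , cycle-regular s ,
    card≥ (verts (cycle s)) {vertex s zero ∷ vertex s (suc zero) ∷ vertex s (suc (suc zero)) ∷ []}
      ((differ (λ ()) ∷ differ (λ ()) ∷ []) ∷ (differ (λ ()) ∷ []) ∷ [] ∷ [])
      (∈-cycle⁺ s _ ∷ ∈-cycle⁺ s _ ∷ ∈-cycle⁺ s _ ∷ []) ,
    cycle-connected′ s , cycle-deletion s
    where
    differ : ∀ {i j} → i ≢ j → vertex s i ≢ vertex s j
    differ i≢j = i≢j ∘ proj₂ ∘ vertex-injective s s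

  cycle-chordless : ∀ s → Chordless G (cycle s)
  cycle-chordless s e within with edgeView e
  ... | isRim t i with refl ← ∈-cycle⁻ s t i (within _ (touches-before t i)) = rim∈⁺ s i
  ... | isRung i = contradiction
    (trans (∈-cycle⁻ s true i (within _ (touches-spoke true i)))
           (sym (∈-cycle⁻ s false (π i) (within _ (inj₂ (sym (cong proj₂ (ends-rung i)))))))) λ ()

  cycles-disjoint : VertexDisjoint G (cycle true) (cycle false)
  cycles-disjoint = Empty-unique empty
    where
    empty : Empty (verts (cycle true) ∩ verts (cycle false))
    empty (v , v∈) with vertexView v | x∈p∩q⁻ (verts (cycle true)) _ v∈
    ... | isVertex t i | v∈true , v∈false =
      contradiction (trans (sym (∈-cycle⁻ true t i v∈true)) (∈-cycle⁻ false t i v∈false)) λ ()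

  factor : Sub
  factor = part (verts (cycle true) ∪ verts (cycle false)) (edges (cycle true) ∪ edges (cycle false))

  cycle⊑factor : ∀ s → _⊑_ G (cycle s) factor
  cycle⊑factor true  = p⊆p∪q (verts (cycle false)) , p⊆p∪q (edges (cycle false))
  cycle⊑factor false = q⊆p∪q _ _ , q⊆p∪q _ _

  factor-edge : ∀ {e} → e ∈ edges factor → ∃[ s ] RimOf s e
  factor-edge e∈ with x∈p∪q⁻ (edges (cycle true)) _ e∈
  ... | inj₁ e∈′ = true , rimView true e∈′
  ... | inj₂ e∈′ = false , rimView false e∈′

  factor-spanning : ∀ v → v ∈ verts factor
  factor-spanning v with vertexView v
  ... | isVertex s i = proj₁ (cycle⊑factor s) (∈-cycle⁺ s i)

  factor-regular : Regular G 2 factor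
  factor-regular v _ with vertexView v
  ... | isVertex s i = trans (cong ∣_∣ (⊆-antisym shrink grow)) (cycle-regular s _ (∈-cycle⁺ s i))
    where
    grow : edgesAt (vertex s i) ∩ edges (cycle s) ⊆ edgesAt (vertex s i) ∩ edges factor
    grow e∈ = let at , rim∈ = x∈p∩q⁻ (edgesAt (vertex s i)) _ e∈ in x∈p∩q⁺ (at , proj₂ (cycle⊑factor s) rim∈)
    shrink : edgesAt (vertex s i) ∩ edges factor ⊆ edgesAt (vertex s i) ∩ edges (cycle s)
    shrink e∈ with x∈p∩q⁻ (edgesAt (vertex s i)) _ e∈
    ... | at , e∈F with factor-edge e∈F
    ... | t , rimOf j with refl ← proj₁ (touches-rim⁻ s i t j (∈-edgesAt⁻ at)) = x∈p∩q⁺ (at , rim∈⁺ s j)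

  factor-permutation : IsPermutationTwoFactor G factor
  factor-permutation =
    ((λ {v} _ _ → factor-spanning v) , ⊆-antisym ⊆⊤ (λ {v} _ → factor-spanning v) , factor-regular) ,
    cycle true , cycle false , cycle-circuit true , cycle-chordless true ,
    cycle-circuit false , cycle-chordless false , cycles-disjoint , refl

  -- All edges of `factor` are rim edges, and a rim edge never changes cycle, so a connected
  -- subgraph of `factor` that meets a cycle stays on it.
  cycle-component : ∀ s → IsComponent G (cycle s) factor
  cycle-component s = cycle-subgraph s , cycle⊑factor s , cycle-connected′ s , maximal
    where
    maximal : ∀ L → IsSubgraph G L → _⊑_ G L factor → Connected G L → _⊑_ G (cycle s) L → _⊑_ G L (cycle s)
    maximal L sub L⊑F (_ , connected) C⊑L = verts⊆ , edges⊆
      where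
      stay : ∀ {u v} → Star (Adjacent G L) u v → u ∈ verts (cycle s) → v ∈ verts (cycle s)
      stay ε u∈ = u∈
      stay ((e , e∈ , joins) ◅ path) u∈ = stay path (across joins)
        where
        side : ∀ {x y} → ends′ e ≡ (x , y) → x ∈ verts (cycle s) ⊎ y ∈ verts (cycle s) →
               x ∈ verts (cycle s) × y ∈ verts (cycle s)
        side eq either with factor-edge (proj₂ L⊑F e∈)
        ... | t , rimOf i with refl ← trans (sym eq) (ends-rim t i) with either
        ... | inj₁ x∈ with refl ← ∈-cycle⁻ s t (prev i) x∈ = ∈-cycle⁺ s _ , ∈-cycle⁺ s _
        ... | inj₂ y∈ with refl ← ∈-cycle⁻ s t i y∈ = ∈-cycle⁺ s _ , ∈-cycle⁺ s _
        across : ∀ {w} → ends′ e ≡ (_ , w) ⊎ ends′ e ≡ (w , _) → w ∈ verts (cycle s)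
        across (inj₁ eq) = proj₂ (side eq (inj₁ u∈))
        across (inj₂ eq) = proj₁ (side eq (inj₂ u∈))
      verts⊆ : verts L ⊆ verts (cycle s)
      verts⊆ {v} v∈ = stay (connected _ v (proj₁ C⊑L (∈-cycle⁺ s zero)) v∈) (∈-cycle⁺ s zero)
      edges⊆ : edges L ⊆ edges (cycle s)
      edges⊆ e∈ with factor-edge (proj₂ L⊑F e∈)
      ... | t , rimOf i with refl ← ∈-cycle⁻ s t i (verts⊆ (sub e∈ (touches-before t i))) = rim∈⁺ s i

  -- Circuit double covers and edge colourings

  Realises : {L : Set} → (Bool → Fin k → L) → Set
  Realises ℓ = ∀ i → Matched (ℓ true i) (ℓ true (next i)) (ℓ false (π i)) (ℓ false (next (π i)))

  module _ (S : List Sub) (cover : IsCircuitDoubleCover G S) (contained : ContainedIn G factor S) where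

    private
      through : Fin (k + (k + k)) → List Sub
      through e = filter (λ C → e ∈? edges C) S

      through-unique : ∀ e → Unique (through e)
      through-unique e = Unique.filter⁺ (λ C → e ∈? edges C) (proj₁ cover)

      twice : ∀ e → length (through e) ≡ 2
      twice = proj₂ (proj₂ cover)

      circuit : ∀ {C} → C List.∈ S → IsCircuit G C
      circuit C∈ = All.lookup (proj₁ (proj₂ cover)) C∈

      through⁺ : ∀ e {C} → C List.∈ S → e ∈ edges C → C List.∈ through e
      through⁺ e = ∈-filter⁺ (λ C → e ∈? edges C)

      through⁻ : ∀ e {C} → C List.∈ through e → C List.∈ S × e ∈ edges C
      through⁻ e = ∈-filter⁻ (λ C → e ∈? edges C)

      cycle∈S : ∀ s → cycle s List.∈ S
      cycle∈S s = contained (cycle s) (cycle-component s)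

      partner = λ s i → pair-partner (through-unique (rim s i)) (twice (rim s i))
                          (through⁺ (rim s i) (cycle∈S s) (rim∈⁺ s i))

    label : Bool → Fin k → Sub
    label s i = proj₁ (partner s i)

    label-through : ∀ s i {C} → C List.∈ S → C ≢ cycle s → rim s i ∈ edges C → C ≡ label s i
    label-through s i C∈ C≢ e∈ with proj₂ (proj₂ (proj₂ (partner s i))) (through⁺ (rim s i) C∈ e∈)
    ... | inj₁ eq = contradiction eq C≢
    ... | inj₂ eq = eq

    -- A cycle has no rung, so `C` is not `cycle s`. Being 2-regular, `C` also takes one of the two
    -- rim edges at the vertex, and there it is the circuit other than `cycle s`.
    label-at : ∀ s i {C} → C List.∈ S → rung (spoke s i) ∈ edges C → C ≡ label s i ⊎ C ≡ label s (next i)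
    label-at s i {C} C∈ e∈ = side (twoOfThree (proj₁ (proj₂ (circuit C∈))) s i
                                     (proj₁ (circuit C∈) e∈ (touches-spoke s i)))
      where
      C≢ : C ≢ cycle s
      C≢ refl = rung∉ s (spoke s i) e∈
      side : TwoOfThree C s i → C ≡ label s i ⊎ C ≡ label s (next i)
      side (pass _ _ e∉)  = contradiction e∈ e∉
      side (left p _ _)   = inj₁ (label-through s i C∈ C≢ p)
      side (right _ q _)  = inj₂ (label-through s (next i) C∈ C≢ q)

    label-pair : ∀ s i {C D} → C List.∈ through (rung (spoke s i)) → D List.∈ through (rung (spoke s i)) →
                 C ≢ D → SamePair (label s i) (label s (next i)) C D
    label-pair s i {C} {D} C∈ D∈ C≢D = combine (at C∈) (at D∈)
      where
      at : ∀ {C} → C List.∈ through (rung (spoke s i)) → C ≡ label s i ⊎ C ≡ label s (next i)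
      at C∈ = label-at s i (proj₁ (through⁻ _ C∈)) (proj₂ (through⁻ _ C∈))
      combine : C ≡ label s i ⊎ C ≡ label s (next i) → D ≡ label s i ⊎ D ≡ label s (next i) →
             SamePair (label s i) (label s (next i)) C D
      combine (inj₁ eq) (inj₁ eq′) = contradiction (trans eq (sym eq′)) C≢D
      combine (inj₁ eq) (inj₂ eq′) = inj₁ (sym eq , sym eq′)
      combine (inj₂ eq) (inj₁ eq′) = inj₂ (sym eq′ , sym eq)
      combine (inj₂ eq) (inj₂ eq′) = contradiction (trans eq (sym eq′)) C≢D

    -- The two circuits through the rung are the two labels at either of its ends.
    cover-realises : Realises label
    cover-realises i = realise (pair-elements (through-unique (rung i)) (twice (rung i)))
      where
      realise : ∃[ C ] ∃[ D ] C List.∈ through (rung i) × D List.∈ through (rung i) × C ≢ D →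
                Matched (label true i) (label true (next i)) (label false (π i)) (label false (next (π i)))
      realise (C , D , C∈ , D∈ , C≢D) = samePair-≢ C≢D onC , samePair-join onC onD
        where
        onC : SamePair (label true i) (label true (next i)) C D
        onC = label-pair true i C∈ D∈ C≢D
        onD : SamePair (label false (π i)) (label false (next (π i))) C D
        onD = label-pair false (π i) (subst (λ j → C List.∈ through (rung j)) (sym (σ-π i)) C∈)
                                      (subst (λ j → D List.∈ through (rung j)) (sym (σ-π i)) D∈) C≢D

  -- At either end of a rung the two rim edges carry the two colours that the rung lacks.
  colouring-realises : ∀ (c : Fin (k + (k + k)) → Fin 3) →
    (∀ e f → e ≢ f → (∃[ v ] Touches v e × Touches v f) → c e ≢ c f) → Realises (λ s i → c (rim s i))
  colouring-realises c proper i = proj₁ on-C ,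
    three-colours _ _ _ _ _ (proj₁ on-C) (proj₁ (proj₂ on-C)) (proj₂ (proj₂ on-C))
                            (proj₁ on-D) (proj₁ (proj₂ on-D)) (proj₂ (proj₂ on-D))
    where
    at : ∀ s j → c (rim s j) ≢ c (rim s (next j)) × c (rim s j) ≢ c (rung (spoke s j)) ×
                 c (rim s (next j)) ≢ c (rung (spoke s j))
    at s j = proper _ _ (λ eq → next≢ j (sym (proj₂ (rim-injective s s eq))))
                    (_ , touches-before s j , touches-after s j) ,
             proper _ _ (rim≢rung s j) (_ , touches-before s j , touches-spoke s j) ,
             proper _ _ (rim≢rung s (next j)) (_ , touches-after s j , touches-spoke s j)
    on-C = at true i
    on-D : c (rim false (π i)) ≢ c (rim false (next (π i))) × c (rim false (π i)) ≢ c (rung i) ×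
           c (rim false (next (π i))) ≢ c (rung i)
    on-D = subst (λ j → c (rim false (π i)) ≢ c (rim false (next (π i))) × c (rim false (π i)) ≢ c (rung j) ×
                        c (rim false (next (π i))) ≢ c (rung j)) (σ-π i) (at false (π i))

  -- Girth and cyclic connectivity

  variation : (Fin k → Bool) → ℕ
  variation P = ∣ tabulate (λ j → P (prev j) xor P j) ∣

  -- `P` marks the matching edges in the order of C, and `P ∘ σ` reads the marks along D. At most
  -- two changes means that the marked set is empty, everything or an interval.
  Simple : Set
  Simple = ∀ (P : Fin k → Bool) → variation P ≤ 2 → variation (P ∘ σ) ≤ 2 →
           ∃[ c ] (∀ i j → P i ≡ c → P j ≡ c → i ≡ j)

  first-five : List (Fin k)
  first-five = zero ∷ suc zero ∷ suc (suc zero) ∷ suc (suc (suc zero)) ∷ suc (suc (suc (suc zero))) ∷ []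

  first-five-unique : Unique first-five
  first-five-unique =
    ((λ ()) ∷ (λ ()) ∷ (λ ()) ∷ (λ ()) ∷ []) ∷ ((λ ()) ∷ (λ ()) ∷ (λ ()) ∷ []) ∷
    ((λ ()) ∷ (λ ()) ∷ []) ∷ ((λ ()) ∷ []) ∷ [] ∷ []

  -- With no rung available, `H` must pass each of its vertices on this cycle along the rim, and so
  -- runs all the way round.
  rims-closed : ∀ {H} → IsSubgraph G H → Regular G 2 H → ∀ s → (∀ i → rung (spoke s i) ∉ edges H) →
                ∀ {a} → vertex s a ∈ verts H → ∀ i → rim s i ∈ edges H
  rims-closed {H} sub regular s no-rung a∈ i = rim∈ i (prev-closed {S = λ i → vertex s i ∈ verts H}
                                                 (λ i i∈ → sub (rim∈ i i∈) (touches-prev s i)) a∈ i)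
    where
    rim∈ : ∀ i → vertex s i ∈ verts H → rim s i ∈ edges H
    rim∈ i i∈ with twoOfThree {H} regular s i i∈
    ... | pass p _ _  = p
    ... | left p _ _  = p
    ... | right _ _ r = contradiction r (no-rung i)

  module _ (simple : Simple) where

    near-pair : ∀ (P : Fin k → Bool) a → (∀ j → P j ≡ true → j ≡ a ⊎ j ≡ next a) →
                P a ≡ true → P (next a) ≡ true → variation P ≤ 2
    near-pair P a only Pa Pa′ = card≤ _ (a ∷ next (next a) ∷ []) λ {j} j∈ →
      change j (P j) refl (xor≡true⁻ (∈-tabulate⁻ (λ j → P (prev j) xor P j) j∈))
      where
      change : ∀ j b → P j ≡ b → P (prev j) ≢ P j → j List.∈ a ∷ next (next a) ∷ []
      change j true Pj differ with only j Pj
      ... | inj₁ refl = here refl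
      ... | inj₂ refl = contradiction (trans (cong P (prev-next a)) (trans Pa (sym Pj))) differ
      change j false Pj differ with only (prev j) (Bool.¬-not (λ eq → differ (trans eq (sym Pj))))
      ... | inj₁ eq = contradiction (trans (sym Pa′) (trans (cong P (trans (cong next (sym eq)) (next-prev j))) Pj)) λ ()
      ... | inj₂ eq = there (here (trans (sym (next-prev j)) (cong next eq)))

    next²≢ : (i : Fin k) → next (next i) ≢ i
    next²≢ i eq = prev²≢ i (trans (cong (prev ∘ prev) (sym eq)) (trans (cong prev (prev-next (next i))) (prev-next i)))

    next³≢ : (i : Fin k) → next (next (next i)) ≢ i
    next³≢ i eq = prev³≢ i (trans (cong (prev ∘ prev ∘ prev) (sym eq))
      (trans (cong (prev ∘ prev) (prev-next (next (next i)))) (trans (cong prev (prev-next (next i))) (prev-next i))))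

    -- The two matching edges of a square are consecutive on both cycles, so marking them gives at
    -- most two changes on each. Neither colour is confined to one matching edge: two and three
    -- steps after `i` lie two different unmarked ones.
    no-square : ∀ i j → ¬ SamePair (π i) (π (next i)) j (next j)
    no-square i j pair = conclude (simple P ring≤ (word≤ pair))
      where
      P : Fin k → Bool
      P l = does (l Fin.≟ i) ∨ does (l Fin.≟ next i)
      P⁻ : ∀ l → P l ≡ true → l ≡ i ⊎ l ≡ next i
      P⁻ l eq with l Fin.≟ i | l Fin.≟ next i
      ... | yes l≡ | _      = inj₁ l≡
      ... | no _   | yes l≡ = inj₂ l≡
      P⁺ : ∀ l → l ≡ i ⊎ l ≡ next i → P l ≡ true
      P⁺ l (inj₁ eq) = cong (_∨ does (l Fin.≟ next i)) (dec-true (l Fin.≟ i) eq)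
      P⁺ l (inj₂ eq) = trans (cong (does (l Fin.≟ i) ∨_) (dec-true (l Fin.≟ next i) eq)) (Bool.∨-zeroʳ _)
      P-false : ∀ l → l ≢ i → l ≢ next i → P l ≡ false
      P-false l l≢ l≢′ = Bool.¬-not λ eq → [ l≢ , l≢′ ]′ (P⁻ l eq)
      ring≤ : variation P ≤ 2
      ring≤ = near-pair P i P⁻ (P⁺ i (inj₁ refl)) (P⁺ (next i) (inj₂ refl))
      back : ∀ {l j} → π l ≡ j → σ j ≡ l
      back {l} eq = trans (cong σ (sym eq)) (σ-π l)
      forth : ∀ {l j} → σ j ≡ l → j ≡ π l
      forth {j = j} eq = trans (sym (π-σ j)) (cong π eq)
      word≤ : SamePair (π i) (π (next i)) j (next j) → variation (P ∘ σ) ≤ 2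
      word≤ (inj₁ (eq , eq′)) = near-pair (P ∘ σ) j
        (λ l h → [ (λ e → inj₁ (trans (forth e) eq)) , (λ e → inj₂ (trans (forth e) eq′)) ]′ (P⁻ (σ l) h))
        (P⁺ _ (inj₁ (back eq))) (P⁺ _ (inj₂ (back eq′)))
      word≤ (inj₂ (eq , eq′)) = near-pair (P ∘ σ) j
        (λ l h → [ (λ e → inj₂ (trans (forth e) eq)) , (λ e → inj₁ (trans (forth e) eq′)) ]′ (P⁻ (σ l) h))
        (P⁺ _ (inj₂ (back eq′))) (P⁺ _ (inj₁ (back eq)))
      conclude : ¬ (∃[ c ] (∀ x y → P x ≡ c → P y ≡ c → x ≡ y))
      conclude (true  , unique) = next≢ i (unique _ _ (P⁺ (next i) (inj₂ refl)) (P⁺ i (inj₁ refl)))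
      conclude (false , unique) = next≢ (next (next i))
        (unique _ _ (P-false _ (next³≢ i) (λ eq → next²≢ i (next-injective eq)))
                    (P-false _ (next²≢ i) (next≢ (next i))))

    Neighbour : Fin k → Fin k → Set
    Neighbour i j = j ≡ next i ⊎ j ≡ prev i

    -- How a circuit that uses the rung at vertex `i` continues on this side: along the rim edge `e`
    -- to the neighbour `j`, then along the rim edge `f` or the rung of `j`.
    record Turn (H : Sub) (s : Bool) (i : Fin k) : Set where
      field
        {j e f}    : Fin k
        neighbour  : Neighbour i j
        e≢f        : e ≢ f
        first      : rim s e ∈ edges H
        second     : rim s f ∈ edges H ⊎ rung (spoke s j) ∈ edges H

    turn : ∀ {H} → IsSubgraph G H → Regular G 2 H → ∀ s i → rung (spoke s i) ∈ edges H → Turn H s i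
    turn {H} sub regular s i r∈ with twoOfThree {H} regular s i (sub r∈ (touches-spoke s i))
    ... | pass _ _ r∉ = contradiction r∈ r∉
    ... | left p _ _ = record { neighbour = inj₂ refl ; e≢f = ≢-sym (prev≢ i) ; first = p ; second = second }
      where
      second : rim s (prev i) ∈ edges H ⊎ rung (spoke s (prev i)) ∈ edges H
      second with twoOfThree {H} regular s (prev i) (sub p (touches-prev s i))
      ... | pass q _ _  = inj₁ q
      ... | left q _ _  = inj₁ q
      ... | right _ _ r = inj₂ r
    ... | right _ p _ = record { neighbour = inj₁ refl ; e≢f = ≢-sym (next≢ (next i)) ; first = p ; second = second }
      where
      second : rim s (next (next i)) ∈ edges H ⊎ rung (spoke s (next i)) ∈ edges H
      second with twoOfThree {H} regular s (next i) (sub p (touches-before s (next i)))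
      ... | pass _ q _  = inj₁ q
      ... | left _ _ r  = inj₂ r
      ... | right _ q _ = inj₁ q

    neighbour≢ : ∀ {i j} → Neighbour i j → j ≢ i
    neighbour≢ {i} (inj₁ refl) = next≢ i
    neighbour≢ {i} (inj₂ refl) = prev≢ i

    square-free : ∀ {i j l} → Neighbour i j → Neighbour (π i) l → π j ≢ l
    square-free {i} (inj₁ refl) (inj₁ refl) eq = no-square i (π i) (inj₁ (refl , eq))
    square-free {i} (inj₁ refl) (inj₂ refl) eq =
      no-square i (prev (π i)) (inj₂ (sym (next-prev (π i)) , eq))
    square-free {i} (inj₂ refl) (inj₁ refl) eq =
      no-square (prev i) (π i) (inj₂ (eq , cong π (next-prev i)))
    square-free {i} (inj₂ refl) (inj₂ refl) eq =
      no-square (prev i) (prev (π i)) (inj₁ (eq , trans (cong π (next-prev i)) (sym (next-prev (π i)))))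

    -- A circuit without rungs is a whole cycle and has at least five edges. Otherwise it contains a
    -- rung and two further edges beyond each end of it. These five are distinct unless both
    -- outermost ones are the same rung, which would close a square.
    girth : GirthAtLeast G 5
    girth H (sub , regular , _ , (start , _) , _) with any? (λ i → rung i ∈? edges H)
    ... | no none = around start
      where
      around : Nonempty (verts H) → 5 ≤ ∣ edges H ∣
      around (v , v∈) with vertexView v
      ... | isVertex s a = card≥ (edges H) (Unique.map⁺ (proj₂ ∘ rim-injective s s) first-five-unique)
        (All.map⁺ (All.tabulate λ {i} _ → rims-closed {H} sub regular s (λ i r∈ → none (spoke s i , r∈)) v∈ i))
    ... | yes (i , r∈) = five (Turn.second t) (Turn.second u)
      where
      t = turn {H} sub regular true i r∈
      u = turn {H} sub regular false (π i) (subst (λ j → rung j ∈ edges H) (sym (σ-π i)) r∈)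
      open Turn t using (j; e; f; e≢f)
      open Turn u using () renaming (j to j′; e to e′; f to f′; e≢f to e′≢f′)
      distinct : ∀ s {x y} → x ≢ y → rim s x ≢ rim s y
      distinct s x≢y = x≢y ∘ proj₂ ∘ rim-injective s s
      opposite : ∀ x y → rim true x ≢ rim false y
      opposite x y eq with () ← proj₁ (rim-injective true false {x} {y} eq)
      i≢j : rung i ≢ rung j
      i≢j eq = neighbour≢ (Turn.neighbour t) (sym (rung-injective eq))
      i≢j′ : rung i ≢ rung (σ j′)
      i≢j′ eq = neighbour≢ (Turn.neighbour u) (trans (sym (π-σ j′)) (cong π (sym (rung-injective eq))))
      j≢j′ : rung j ≢ rung (σ j′)
      j≢j′ eq = square-free (Turn.neighbour t) (Turn.neighbour u) (trans (cong π (rung-injective eq)) (π-σ j′))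
      five : rim true f ∈ edges H ⊎ rung j ∈ edges H → rim false f′ ∈ edges H ⊎ rung (σ j′) ∈ edges H →
             5 ≤ ∣ edges H ∣
      five (inj₁ f∈) (inj₁ f′∈) = card≥ (edges H)
        {rung i ∷ rim true e ∷ rim false e′ ∷ rim true f ∷ rim false f′ ∷ []}
        ((≢-sym (rim≢rung true e) ∷ ≢-sym (rim≢rung false e′) ∷ ≢-sym (rim≢rung true f) ∷
          ≢-sym (rim≢rung false f′) ∷ []) ∷
         (opposite e e′ ∷ distinct true e≢f ∷ opposite e f′ ∷ []) ∷
         (≢-sym (opposite f e′) ∷ distinct false e′≢f′ ∷ []) ∷ (opposite f f′ ∷ []) ∷ [] ∷ [])
        (r∈ ∷ Turn.first t ∷ Turn.first u ∷ f∈ ∷ f′∈ ∷ [])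
      five (inj₂ f∈) (inj₁ f′∈) = card≥ (edges H)
        {rung i ∷ rim true e ∷ rim false e′ ∷ rung j ∷ rim false f′ ∷ []}
        ((≢-sym (rim≢rung true e) ∷ ≢-sym (rim≢rung false e′) ∷ i≢j ∷ ≢-sym (rim≢rung false f′) ∷ []) ∷
         (opposite e e′ ∷ rim≢rung true e ∷ opposite e f′ ∷ []) ∷
         (rim≢rung false e′ ∷ distinct false e′≢f′ ∷ []) ∷ (≢-sym (rim≢rung false f′) ∷ []) ∷ [] ∷ [])
        (r∈ ∷ Turn.first t ∷ Turn.first u ∷ f∈ ∷ f′∈ ∷ [])
      five (inj₁ f∈) (inj₂ f′∈) = card≥ (edges H)
        {rung i ∷ rim true e ∷ rim false e′ ∷ rim true f ∷ rung (σ j′) ∷ []}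
        ((≢-sym (rim≢rung true e) ∷ ≢-sym (rim≢rung false e′) ∷ ≢-sym (rim≢rung true f) ∷ i≢j′ ∷ []) ∷
         (opposite e e′ ∷ distinct true e≢f ∷ rim≢rung true e ∷ []) ∷
         (≢-sym (opposite f e′) ∷ rim≢rung false e′ ∷ []) ∷ (rim≢rung true f ∷ []) ∷ [] ∷ [])
        (r∈ ∷ Turn.first t ∷ Turn.first u ∷ f∈ ∷ f′∈ ∷ [])
      five (inj₂ f∈) (inj₂ f′∈) = card≥ (edges H)
        {rung i ∷ rim true e ∷ rim false e′ ∷ rung j ∷ rung (σ j′) ∷ []}
        ((≢-sym (rim≢rung true e) ∷ ≢-sym (rim≢rung false e′) ∷ i≢j ∷ i≢j′ ∷ []) ∷
         (opposite e e′ ∷ rim≢rung true e ∷ rim≢rung true e ∷ []) ∷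
         (rim≢rung false e′ ∷ rim≢rung false e′ ∷ []) ∷ (j≢j′ ∷ []) ∷ [] ∷ [])
        (r∈ ∷ Turn.first t ∷ Turn.first u ∷ f∈ ∷ f′∈ ∷ [])

  -- Cyclic edge cuts

  edge-count : ∀ (X : Subset (k + (k + k))) →
    ∣ X ∣ ≡ ∣ pullback (rim true) X ∣ + (∣ pullback (rim false) X ∣ + ∣ pullback rung X ∣)
  edge-count X = trans (card-split k X) (cong (∣ pullback (rim true) X ∣ +_)
    (trans (card-split k Y) (cong₂ _+_ (composite (_↑ˡ k)) (composite (k ↑ʳ_)))))
    where
    Y = pullback (k ↑ʳ_) X
    composite : ∀ (f : Fin k → Fin (k + k)) → ∣ pullback f Y ∣ ≡ ∣ pullback ((k ↑ʳ_) ∘ f) X ∣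
    composite f = cong ∣_∣ (tabulate-cong λ i → lookup∘tabulate (lookup X ∘ (k ↑ʳ_)) (f i))

  -- Otherwise colour `c` would be closed under `prev` and hence fill the whole cycle.
  switch : ∀ (P : Fin k → Bool) c {a b} → P a ≡ c → P b ≡ not c → ∃[ i ] P i ≡ c × P (prev i) ≡ not c
  switch P c {a} {b} Pa Pb with any? (λ i → (P i Bool.≟ c) ×-dec (P (prev i) Bool.≟ not c))
  ... | yes found = found
  ... | no none   = contradiction (trans (sym Pb) (prev-closed {S = λ i → P i ≡ c} closed Pa b)) (Bool.not-¬ refl ∘ sym)
    where
    closed : ∀ i → P i ≡ c → P (prev i) ≡ c
    closed i Pi = trans (Bool.¬-not (λ eq → none (i , Pi , eq))) (Bool.not-involutive c)

  Mixed : (Fin k → Bool) → Set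
  Mixed P = ∀ c → ∃[ a ] P a ≡ c

  mixed? : ∀ P → (∃[ c ] ∀ i → P i ≡ c) ⊎ Mixed P
  mixed? P with any? (λ i → P i Bool.≟ true) | any? (λ i → P i Bool.≟ false)
  ... | no none | _       = inj₁ (false , λ i → Bool.¬-not (λ eq → none (i , eq)))
  ... | yes _   | no none = inj₁ (true , λ i → Bool.¬-not (λ eq → none (i , eq)))
  ... | yes t   | yes f   = inj₂ λ { true → t ; false → f }

  mixed-variation : ∀ P → Mixed P → 2 ≤ variation P
  mixed-variation P mixed
    with switch P true (proj₂ (mixed true)) (proj₂ (mixed false))
       | switch P false (proj₂ (mixed false)) (proj₂ (mixed true))
  ... | i , Pi , Pi′ | j , Pj , Pj′ = card≥ _ {i ∷ j ∷ []}
    (((λ { refl → contradiction (trans (sym Pi) Pj) λ () }) ∷ []) ∷ [] ∷ [])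
    (∈-tabulate⁺ (λ j → P (prev j) xor P j) (cong₂ _xor_ Pi′ Pi) ∷
     ∈-tabulate⁺ (λ j → P (prev j) xor P j) (cong₂ _xor_ Pj′ Pj) ∷ [])

  module _ (simple : Simple) (X : Subset (k + (k + k))) (p : Fin (k + k) → Bool)
           (cut : ∀ e {u w} → ends′ e ≡ (u , w) → p u ≢ p w → e ∈ X)
           (Γ : Bool → Sub) (circuit : ∀ c → IsCircuit G (Γ c))
           (coloured : ∀ c v → v ∈ verts (Γ c) → p v ≡ c) where

    private
      P : Bool → Fin k → Bool
      P s i = p (vertex s i)

      some-vertex : ∀ c → ∃[ v ] v ∈ verts (Γ c)
      some-vertex c = proj₁ (proj₁ (proj₂ (proj₂ (proj₂ (circuit c)))))

      rims≥ : ∀ s → variation (P s) ≤ ∣ pullback (rim s) X ∣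
      rims≥ s = p⊆q⇒∣p∣≤∣q∣ λ {j} j∈ → ∈-pullback (rim s) X
        (cut (rim s j) (ends-rim s j) (xor≡true⁻ (∈-tabulate⁻ (λ j → P s (prev j) xor P s j) j∈)))

      rung∈ : ∀ i → P true i ≢ P false (π i) → i ∈ pullback rung X
      rung∈ i differ = ∈-pullback rung X (cut (rung i) (ends-rung i) differ)

      total : ∀ {a b c} → a ≤ ∣ pullback (rim true) X ∣ → b ≤ ∣ pullback (rim false) X ∣ →
              c ≤ ∣ pullback rung X ∣ → a + (b + c) ≤ ∣ X ∣
      total a≤ b≤ c≤ = ℕ.≤-trans (ℕ.+-mono-≤ a≤ (ℕ.+-mono-≤ b≤ c≤)) (ℕ.≤-reflexive (sym (edge-count X)))

      -- The circuit of the other colour avoids cycle `s`, hence all rungs, since each of them ends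
      -- there. It is therefore the whole opposite cycle, which then has only one colour.
      coloured-opposite : ∀ s c → (∀ i → P s i ≡ c) → ¬ Mixed (P (not s))
      coloured-opposite s c all mixed with some-vertex (not c)
      ... | v , v∈ with vertexView v
      ... | isVertex t a with t Bool.≟ s
      ... | yes refl = Bool.not-¬ refl (trans (sym (all a)) (coloured (not c) _ v∈))
      ... | no t≢s with refl ← Bool.¬-not t≢s = Bool.not-¬ refl (trans (sym Pb) (coloured (not c) _ b∈))
        where
        b = proj₁ (mixed c)
        Pb = proj₂ (mixed c)
        sub = proj₁ (circuit (not c))
        no-rung : ∀ i → rung (spoke (not s) i) ∉ edges (Γ (not c))
        no-rung i r∈ = Bool.not-¬ refl (trans (sym (all (other s))) (coloured (not c) _ (sub r∈ (touches s))))
          where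
          other : Bool → Fin k
          other true  = σ i
          other false = π i
          touches : ∀ s → Touches (vertex s (other s)) (rung (spoke (not s) i))
          touches true  = touches-spoke true (σ i)
          touches false = inj₂ (sym (cong proj₂ (ends-rung i)))
        b∈ : vertex (not s) b ∈ verts (Γ (not c))
        b∈ = sub (rims-closed {Γ (not c)} sub (proj₁ (proj₂ (circuit (not c)))) (not s) no-rung v∈ b)
                    (touches-before (not s) b)

      unequal : ∀ c → (∀ i → P true i ≡ c) → (∀ i → P false i ≡ not c) → 5 ≤ ∣ X ∣
      unequal c all all′ = total {0} {0} {5} z≤n z≤n (card≥ (pullback rung X) first-five-unique
        (All.tabulate λ {i} _ → rung∈ i λ eq → Bool.not-¬ refl (trans (sym (all i)) (trans eq (all′ (π i))))))

      module _ (agree : ∀ i → P true i ≡ P false (π i)) where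

        spoke-colour : ∀ t l → P true (spoke t l) ≡ P t l
        spoke-colour true  l = refl
        spoke-colour false l = trans (agree (σ l)) (cong (P false) (π-σ l))

        -- Rungs are monochromatic here, so a single rung of colour `c` leaves two vertices of that
        -- colour, while the circuit `Γ c` has at least three.
        not-unique : ∀ c → ¬ (∀ i j → P true i ≡ c → P true j ≡ c → i ≡ j)
        not-unique c unique with some-vertex c
        ... | v , v∈ with vertexView v
        ... | isVertex s a = contradiction (ℕ.≤-trans (proj₁ (proj₂ (proj₂ (circuit c)))) (card≤ _ pair within))
                                           λ { (s≤s (s≤s ())) }
          where
          i = spoke s a
          pair = vertex true i ∷ vertex false (π i) ∷ []
          colour : ∀ t l → vertex t l ∈ verts (Γ c) → P true (spoke t l) ≡ c
          colour t l l∈ = trans (spoke-colour t l) (coloured c _ l∈)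
          at : ∀ t l → spoke t l ≡ i → vertex t l List.∈ pair
          at true  l eq = here (cong (vertex true) eq)
          at false l eq = there (here (cong (vertex false) (trans (sym (π-σ l)) (cong π eq))))
          within : ∀ {u} → u ∈ verts (Γ c) → u List.∈ pair
          within {u} u∈ with vertexView u
          ... | isVertex t l = at t l (unique _ _ (colour t l u∈) (colour s a v∈))

    -- With both colours on each cycle, the bound arises as 2 + 2 + 1 if some rung is bichromatic,
    -- and as 3 + 2 if a cycle changes colour more than twice. The remaining case contradicts
    -- `simple`.
    5≤cut : 5 ≤ ∣ X ∣
    5≤cut with mixed? (P true) | mixed? (P false)
    ... | inj₁ (c , all) | inj₂ mixed = contradiction mixed (coloured-opposite true c all)
    ... | inj₂ mixed | inj₁ (c , all) = contradiction mixed (coloured-opposite false c all)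
    ... | inj₁ (c , all) | inj₁ (d , all′) with d Bool.≟ c
    ...   | no d≢c with refl ← Bool.¬-not d≢c = unequal c all all′
    ...   | yes refl with some-vertex (not c)
    ...     | v , v∈ with vertexView v
    ...       | isVertex true a  = contradiction (trans (sym (all a)) (coloured (not c) _ v∈)) (Bool.not-¬ refl)
    ...       | isVertex false a = contradiction (trans (sym (all′ a)) (coloured (not c) _ v∈)) (Bool.not-¬ refl)
    5≤cut | inj₂ mixed | inj₂ mixed′ with any? (λ i → ¬? (P true i Bool.≟ P false (π i)))
    ... | yes (i , differ) = total {2} {2} {1} (ℕ.≤-trans (mixed-variation _ mixed) (rims≥ true))
            (ℕ.≤-trans (mixed-variation _ mixed′) (rims≥ false)) (card≥ _ {i ∷ []} ([] ∷ []) (rung∈ i differ ∷ []))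
    ... | no same = balanced (variation (P true) ℕ.≤? 2) (variation (P false) ℕ.≤? 2)
      where
      agree : ∀ i → P true i ≡ P false (π i)
      agree i = decidable-stable (P true i Bool.≟ P false (π i)) (λ differ → same (i , differ))
      balanced : Dec (variation (P true) ≤ 2) → Dec (variation (P false) ≤ 2) → 5 ≤ ∣ X ∣
      balanced (no many) _ = total {3} {2} {0} (ℕ.≤-trans (ℕ.≰⇒> many) (rims≥ true))
        (ℕ.≤-trans (mixed-variation _ mixed′) (rims≥ false)) z≤n
      balanced (yes _) (no many) = total {2} {3} {0} (ℕ.≤-trans (mixed-variation _ mixed) (rims≥ true))
        (ℕ.≤-trans (ℕ.≰⇒> many) (rims≥ false)) z≤n
      balanced (yes few) (yes few′) with simple (P true) few
        (ℕ.≤-trans (ℕ.≤-reflexive (cong ∣_∣ (tabulate-cong λ j →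
          cong₂ _xor_ (spoke-colour agree false (prev j)) (spoke-colour agree false j)))) few′)
      ... | c , unique = contradiction unique (not-unique agree c)

  module _ {X : Subset (k + (k + k))} {K : Sub} (component : IsComponent G K (deleteEdges G X)) where

    private
      K-subgraph = proj₁ component
      K-connected = proj₁ (proj₂ (proj₂ component))
      K-avoids = proj₂ (proj₁ (proj₂ component))

    -- Adding `e` and its ends to `K` gives a connected subgraph that still avoids `X`, so it lies
    -- in `K` by maximality.
    component-extends : ∀ {e v} → e ∉ X → v ∈ verts K → Touches v e →
                        e ∈ edges K × (∀ {w} → Touches w e → w ∈ verts K)
    component-extends {e} {v} e∉X v∈ v-e =
      proj₂ L⊑K (q⊆p∪q (edges K) ⁅ e ⁆ (x∈⁅x⁆ e)) , λ w-e → proj₁ L⊑K (end∈ w-e)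
      where
      a = proj₁ (ends′ e)
      b = proj₂ (ends′ e)
      L : Sub
      L = part (verts K ∪ (⁅ a ⁆ ∪ ⁅ b ⁆)) (edges K ∪ ⁅ e ⁆)
      end∈ : ∀ {w} → Touches w e → w ∈ verts L
      end∈ (inj₁ refl) = q⊆p∪q (verts K) _ (p⊆p∪q ⁅ b ⁆ (x∈⁅x⁆ a))
      end∈ (inj₂ refl) = q⊆p∪q (verts K) _ (q⊆p∪q ⁅ a ⁆ _ (x∈⁅x⁆ b))
      vertex∈ : ∀ {w} → w ∈ verts L → w ∈ verts K ⊎ Touches w e
      vertex∈ w∈ with x∈p∪q⁻ (verts K) _ w∈
      ... | inj₁ w∈K = inj₁ w∈K
      ... | inj₂ w∈e with x∈p∪q⁻ ⁅ a ⁆ ⁅ b ⁆ w∈e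
      ...   | inj₁ w∈a = inj₂ (inj₁ (x∈⁅y⁆⇒x≡y a w∈a))
      ...   | inj₂ w∈b = inj₂ (inj₂ (x∈⁅y⁆⇒x≡y b w∈b))
      edge∈ : ∀ {f} → f ∈ edges L → f ∈ edges K ⊎ f ≡ e
      edge∈ f∈ with x∈p∪q⁻ (edges K) _ f∈
      ... | inj₁ f∈K = inj₁ f∈K
      ... | inj₂ f∈e = inj₂ (x∈⁅y⁆⇒x≡y e f∈e)
      L-subgraph : IsSubgraph G L
      L-subgraph f∈ t with edge∈ f∈
      ... | inj₁ f∈K  = p⊆p∪q _ (K-subgraph f∈K t)
      ... | inj₂ refl = end∈ t
      L-avoids : edges L ⊆ ∁ X
      L-avoids f∈ with edge∈ f∈
      ... | inj₁ f∈K  = K-avoids f∈K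
      ... | inj₂ refl = x∉p⇒x∈∁p e∉X
      e∈L : e ∈ edges L
      e∈L = q⊆p∪q (edges K) _ (x∈⁅x⁆ e)
      across : ∀ {x y} → Touches x e → Touches y e → Star (Adjacent G L) x y
      across (inj₁ refl) (inj₁ refl) = ε
      across (inj₁ refl) (inj₂ refl) = (e , e∈L , inj₁ refl) ◅ ε
      across (inj₂ refl) (inj₁ refl) = (e , e∈L , inj₂ refl) ◅ ε
      across (inj₂ refl) (inj₂ refl) = ε
      to-v : ∀ {w} → w ∈ verts L → Star (Adjacent G L) w v
      to-v w∈ with vertex∈ w∈
      ... | inj₁ w∈K = Star.gmap id (λ (f , f∈ , joins) → f , p⊆p∪q ⁅ e ⁆ f∈ , joins)
                                    (proj₂ K-connected _ _ w∈K v∈)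
      ... | inj₂ w-e = across w-e v-e
      L-connected : Connected G L
      L-connected = (v , p⊆p∪q _ v∈) ,
        λ x y x∈ y∈ → to-v x∈ ◅◅ reverse (adjacent-sym {L}) (to-v y∈)
      L⊑K : _⊑_ G L K
      L⊑K = proj₂ (proj₂ (proj₂ component)) L L-subgraph (⊆⊤ , L-avoids) L-connected (p⊆p∪q _ , p⊆p∪q _)

    -- Applied in both directions, this makes two components with a common vertex equal.
    component-absorbs : ∀ {L} → IsComponent G L (deleteEdges G X) → ∀ {v} → v ∈ verts K → v ∈ verts L →
                        _⊑_ G L K
    component-absorbs {L} (L-subgraph , (_ , L-avoids) , (_ , L-connected) , _) {v} v∈K v∈L = verts⊆ , edges⊆
      where
      stay : ∀ {x y} → Star (Adjacent G L) x y → x ∈ verts K → y ∈ verts K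
      stay ε x∈ = x∈
      stay ((e , e∈ , joins) ◅ path) x∈ = stay path (across joins)
        where
        e∉X = x∈∁p⇒x∉p (L-avoids e∈)
        across : ∀ {w} → ends′ e ≡ (_ , w) ⊎ ends′ e ≡ (w , _) → w ∈ verts K
        across (inj₁ eq) = proj₂ (component-extends e∉X x∈ (inj₁ (sym (cong proj₁ eq)))) (inj₂ (sym (cong proj₂ eq)))
        across (inj₂ eq) = proj₂ (component-extends e∉X x∈ (inj₂ (sym (cong proj₂ eq)))) (inj₁ (sym (cong proj₁ eq)))
      verts⊆ : verts L ⊆ verts K
      verts⊆ {w} w∈ = stay (L-connected v w v∈L w∈) v∈K
      edges⊆ : edges L ⊆ edges K
      edges⊆ e∈ = proj₁ (component-extends (x∈∁p⇒x∉p (L-avoids e∈))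
                                           (verts⊆ (L-subgraph e∈ (inj₁ refl))) (inj₁ refl))

  -- Membership in `K` is the colouring: an edge with one end in a component lies in it or in `X`,
  -- and `L` is disjoint from `K`, so the two circuits get different colours.
  cyclic-cut≥5 : Simple → ∀ X → IsCyclicCut G X → 5 ≤ ∣ X ∣
  cyclic-cut≥5 simple X (K , L , K≢L , K-comp , (Γ , Γ-circuit , Γ⊑K) , L-comp , (Δ , Δ-circuit , Δ⊑L)) =
    5≤cut simple X inK crossing circuits circuit coloured
    where
    inK : Fin (k + k) → Bool
    inK v = does (v ∈? verts K)
    disjoint : ∀ {v} → v ∈ verts K → v ∉ verts L
    disjoint v∈K v∈L
      with (vL⊆K , eL⊆K) ← component-absorbs {X} {K} K-comp {L} L-comp v∈K v∈L
         | (vK⊆L , eK⊆L) ← component-absorbs {X} {L} L-comp {K} K-comp v∈L v∈K =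
      K≢L (cong₂ part (⊆-antisym vK⊆L vL⊆K) (⊆-antisym eK⊆L eL⊆K))
    spread : ∀ {e u w} → e ∉ X → Touches u e → Touches w e → u ∈ verts K → w ∈ verts K
    spread e∉X u-e w-e u∈ = proj₂ (component-extends {X} {K} K-comp e∉X u∈ u-e) w-e
    crossing : ∀ e {u w} → ends′ e ≡ (u , w) → inK u ≢ inK w → e ∈ X
    crossing e {u} {w} eq differ = decidable-stable (e ∈? X) λ e∉X →
      let u-e = inj₁ (sym (cong proj₁ eq)) ; w-e = inj₂ (sym (cong proj₂ eq))
      in differ (agree (u ∈? verts K) (w ∈? verts K) (spread e∉X u-e w-e) (spread e∉X w-e u-e))
      where
      agree : ∀ {A B : Set} (a : Dec A) (b : Dec B) → (A → B) → (B → A) → does a ≡ does b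
      agree (yes _) (yes _) _ _ = refl
      agree (yes a) (no ¬b) f _ = contradiction (f a) ¬b
      agree (no ¬a) (yes b) _ g = contradiction (g b) ¬a
      agree (no _)  (no _)  _ _ = refl
    circuits : Bool → Sub
    circuits true  = Γ
    circuits false = Δ
    circuit : ∀ c → IsCircuit G (circuits c)
    circuit true  = Γ-circuit
    circuit false = Δ-circuit
    coloured : ∀ c v → v ∈ verts (circuits c) → inK v ≡ c
    coloured true  v v∈ = dec-true (v ∈? verts K) (proj₁ Γ⊑K v∈)
    coloured false v v∈ = dec-false (v ∈? verts K) (λ v∈K → disjoint v∈K (proj₁ Δ⊑L v∈))

  cyclically-connected : Simple → CyclicallyEdgeConnected G 5
  cyclically-connected simple =
    (cycle true , cycle false , cycle-circuit true , cycle-circuit false , cycles-disjoint) , cyclic-cut≥5 simple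

-- The family

outer-ids : ℕ → List ℕ
outer-ids n = marker n ∷ arc n

arc-length : ∀ n → length (arc n) ≡ 1 + n * 12
arc-length zero    = refl
arc-length (suc n) = cong (8 +_) (begin
  length (map (12 +_) (arc n) ++ 11 ∷ 1 ∷ 5 ∷ 8 ∷ [])  ≡⟨ length-++ (map (12 +_) (arc n)) ⟩
  length (map (12 +_) (arc n)) + 4                     ≡⟨ cong (_+ 4) (length-map (12 +_) (arc n)) ⟩
  length (arc n) + 4                                   ≡⟨ cong (_+ 4) (arc-length n) ⟩
  1 + n * 12 + 4                                       ≡⟨ ℕ.+-comm (1 + n * 12) 4 ⟩
  5 + n * 12                                           ∎)
  where open ≡-Reasoning

word-length : ∀ n → length (word n) ≡ len n
word-length n = cong (4 +_) (trans (length-map (3 +_) (arc n)) (arc-length n))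

outer-bounded : ∀ n → All (_< 2 + n * 12) (outer-ids n)
outer-bounded zero    = s≤s z≤n ∷ s≤s (s≤s z≤n) ∷ []
outer-bounded (suc n) with outer-bounded n
... | β< ∷ arc< = below 4 _ ∷ below 10 _ ∷ below 7 _ ∷ below 9 _ ∷ below 2 _ ∷ below 0 _ ∷ below 3 _ ∷
  ℕ.+-monoʳ-< 12 β< ∷ below 6 _ ∷
  All.++⁺ (All.map⁺ (All.map (ℕ.+-monoʳ-< 12) arc<)) (below 11 _ ∷ below 1 _ ∷ below 5 _ ∷ below 8 _ ∷ [])
  where
  below : ∀ x → T (x <ᵇ 12) → x < 14 + n * 12
  below x x<12 = ℕ.≤-trans (ℕ.<ᵇ⇒< x 12 x<12) (ℕ.m≤m+n 12 _)

outer-complete : ∀ n {x} → x < 2 + n * 12 → x List.∈ outer-ids n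
outer-complete zero {0} _ = here refl
outer-complete zero {1} _ = there (here refl)
outer-complete zero {suc (suc x)} (s≤s (s≤s ()))
outer-complete (suc n) {0}  _ = there (there (there (there (there (here refl)))))
outer-complete (suc n) {1}  _ = there (there (there (there (there (there (there (there (there
                                  (∈-++⁺ʳ (map (12 +_) (arc n)) (there (here refl)))))))))))
outer-complete (suc n) {2}  _ = there (there (there (there (here refl))))
outer-complete (suc n) {3}  _ = there (there (there (there (there (there (here refl))))))
outer-complete (suc n) {4}  _ = here refl
outer-complete (suc n) {5}  _ = there (there (there (there (there (there (there (there (there
                                  (∈-++⁺ʳ (map (12 +_) (arc n)) (there (there (here refl))))))))))))
outer-complete (suc n) {6}  _ = there (there (there (there (there (there (there (there (here refl))))))))
outer-complete (suc n) {7}  _ = there (there (here refl))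
outer-complete (suc n) {8}  _ = there (there (there (there (there (there (there (there (there
                                  (∈-++⁺ʳ (map (12 +_) (arc n)) (there (there (there (here refl)))))))))))))
outer-complete (suc n) {9}  _ = there (there (there (here refl)))
outer-complete (suc n) {10} _ = there (here refl)
outer-complete (suc n) {11} _ = there (there (there (there (there (there (there (there (there
                                  (∈-++⁺ʳ (map (12 +_) (arc n)) (here refl))))))))))
outer-complete (suc n) {suc (suc (suc (suc (suc (suc (suc (suc (suc (suc (suc (suc x)))))))))))} x<
  with outer-complete n (ℕ.+-cancelˡ-< 12 x (2 + n * 12) x<)
... | here refl = there (there (there (there (there (there (there (here refl)))))))
... | there x∈  = there (there (there (there (there (there (there (there (there
                    (∈-++⁺ˡ (∈-map⁺ (12 +_) x∈))))))))))

word-bounded : ∀ n → All (_< len n) (word n)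
word-bounded n with outer-bounded n
... | β< ∷ arc< = s≤s (s≤s (s≤s z≤n)) ∷ s≤s z≤n ∷ ℕ.+-monoʳ-< 3 β< ∷ s≤s (s≤s z≤n) ∷
                  All.map⁺ (All.map (ℕ.+-monoʳ-< 3) arc<)

word-complete : ∀ n {x} → x < len n → x List.∈ word n
word-complete n {0} _ = there (here refl)
word-complete n {1} _ = there (there (there (here refl)))
word-complete n {2} _ = here refl
word-complete n {suc (suc (suc x))} x< with outer-complete n (ℕ.+-cancelˡ-< 3 x (2 + n * 12) x<)
... | here refl = there (there (here refl))
... | there x∈  = there (there (there (there (∈-map⁺ (3 +_) x∈))))

-- Punching out a missed value would give an injection into a smaller set.
injective⇒surjective : ∀ {n} {f : Fin n → Fin n} → (∀ {x y} → f x ≡ f y → x ≡ y) →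
                       ∀ y → ∃[ x ] f x ≡ y
injective⇒surjective {suc n} {f} inj y with any? (λ x → f x Fin.≟ y)
... | yes found = found
... | no missed = contradiction (injective⇒≤ {f = λ x → punchOut (avoid x)} λ {a} {b} eq →
                    inj (punchOut-injective (avoid a) (avoid b) eq)) (ℕ.<-irrefl refl)
  where
  avoid : ∀ x → y ≢ f x
  avoid x eq = missed (x , sym eq)

cast-cast : ∀ {a b} (eq : a ≡ b) (eq′ : b ≡ a) (i : Fin a) → cast eq′ (cast eq i) ≡ i
cast-cast eq eq′ i = toℕ-injective (trans (toℕ-cast eq′ _) (toℕ-cast eq i))

∣∷∣ : ∀ {n} b (v : Subset n) → ∣ b ∷ v ∣ ≡ bit b + ∣ v ∣
∣∷∣ false v = refl
∣∷∣ true  v = refl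

changes-card : ∀ n p → ∣ tabulate {n = n} (λ i → p (toℕ i) xor p (suc (toℕ i))) ∣ ≡ changes p n
changes-card zero    p = refl
changes-card (suc n) p =
  trans (∣∷∣ (p 0 xor p 1) (tabulate {n = n} λ i → p (suc (toℕ i)) xor p (suc (suc (toℕ i)))))
        (cong (flip? (p 0) (p 1) +_) (changes-card n (p ∘ suc)))

changesFrom-list : ∀ (p f : ℕ → Bool) xs → (∀ j → p (List.lookup xs j) ≡ f (suc (toℕ j))) →
  changesFrom (f 0) (map p xs) ≡ changes f (length xs) × lastFrom (f 0) (map p xs) ≡ f (length xs)
changesFrom-list p f []       h = refl , refl
changesFrom-list p f (x ∷ xs) h rewrite h zero =
  let u , v = changesFrom-list p (f ∘ suc) xs (h ∘ suc) in cong (flip? (f 0) (f 1) +_) u , v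

module Family (n : ℕ) where

  σ : Fin (len n) → Fin (len n)
  σ j = fromℕ< (All.lookup (word-bounded n) (∈-lookup {xs = word n} (cast (sym (word-length n)) j)))

  σ-lookup : ∀ j → toℕ (σ j) ≡ List.lookup (word n) (cast (sym (word-length n)) j)
  σ-lookup j = toℕ-fromℕ< _

  π : Fin (len n) → Fin (len n)
  π i = cast (word-length n) (index (word-complete n (toℕ<n i)))

  σ-π : ∀ i → σ (π i) ≡ i
  σ-π i = toℕ-injective (trans (σ-lookup (π i))
    (trans (cong (List.lookup (word n)) (cast-cast (word-length n) (sym (word-length n)) (index i∈)))
           (sym (lookup-index i∈))))
    where i∈ = word-complete n (toℕ<n i)

  -- `π` is injective by `σ-π`, hence onto by finiteness. That `word n` has no repetitions thus
  -- follows from its length and completeness.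
  π-σ : ∀ j → π (σ j) ≡ j
  π-σ j with injective⇒surjective {f = π} (λ {x} {y} eq → trans (sym (σ-π x)) (trans (cong σ eq) (σ-π y))) j
  ... | i , refl = cong π (σ-π i)

  -- Reading positions modulo `len n` closes both cycles; opacity keeps the division from unfolding
  -- in later types.
  abstract
    at : ℕ → Fin (len n)
    at i = i mod len n

    toℕ-at : ∀ i → toℕ (at i) ≡ i % len n
    toℕ-at i = toℕ-fromℕ< (m%n<n i (len n))

    at-toℕ : ∀ i → at (toℕ i) ≡ i
    at-toℕ i = toℕ-injective (trans (toℕ-at (toℕ i)) (m<n⇒m%n≡m (toℕ<n i)))

    at-suc : ∀ i → at (suc (toℕ i)) ≡ next i
    at-suc i with view i
    ... | ‵fromℕ     = toℕ-injective (trans (toℕ-at (suc (toℕ (fromℕ (4 + n * 12)))))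
                         (trans (cong (λ x → suc x % len n) (toℕ-fromℕ (4 + n * 12))) (n%n≡0 (len n))))
    ... | ‵inject₁ j = toℕ-injective (trans (toℕ-at (suc (toℕ (inject₁ j))))
                         (trans (cong (λ x → suc x % len n) (toℕ-inject₁ j)) (m<n⇒m%n≡m (toℕ<n (suc j)))))

    at-len : at (len n) ≡ at 0
    at-len = toℕ-injective (trans (toℕ-at (len n)) (trans (n%n≡0 (len n)) (sym (toℕ-at 0))))

  open CyclePermutation (n * 12) π σ σ-π π-σ public

  -- The type `L` stays arbitrary because this serves twice: with circuits for the double covers and
  -- with three colours for the edge colourings.
  not-realised : ∀ {L : Set} (ℓ : Bool → Fin (len n) → L) → ¬ Realises ℓ
  not-realised {L} ℓ realises = unrealisable n (A , cong (ℓ true) (sym at-len) , B 0 ,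
    subst (Chain (Rung A) (B 0) (word n)) (trans (cong B (word-length n)) (cong (ℓ false) at-len))
      (Chain-lookup B (word n) matched))
    where
    A B : ℕ → L
    A i = ℓ true (at i)
    B i = ℓ false (at i)
    transport : ∀ {a a′ b b′ c c′ d d′ : L} → a ≡ a′ → b ≡ b′ → c ≡ c′ → d ≡ d′ →
                Matched a b c d → Matched a′ b′ c′ d′
    transport refl refl refl refl r = r
    matched : ∀ j → Rung A (List.lookup (word n) j) (B (toℕ j)) (B (suc (toℕ j)))
    matched j = transport
      (cong (ℓ true) (trans (sym (at-toℕ i)) (cong at i≡)))
      (cong (ℓ true) (trans (sym (at-suc i)) (cong (λ x → at (suc x)) i≡)))
      (cong (ℓ false) (trans (π-σ j′) (trans (sym (at-toℕ j′)) (cong at j≡))))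
      (cong (ℓ false) (trans (cong next (π-σ j′)) (trans (sym (at-suc j′)) (cong (λ x → at (suc x)) j≡))))
      (realises i)
      where
      j′ : Fin (len n)
      j′ = cast (word-length n) j
      i : Fin (len n)
      i = σ j′
      i≡ : toℕ i ≡ List.lookup (word n) j
      i≡ = trans (σ-lookup j′) (cong (List.lookup (word n)) (cast-cast (word-length n) (sym (word-length n)) j))
      j≡ : toℕ j′ ≡ toℕ j
      j≡ = toℕ-cast (word-length n) j

  -- The index `zero` accounts for the step across the wraparound, the others for the linear steps.
  variation-ring : ∀ (Q : Fin (len n) → Bool) → let f = λ i → Q (at i) in
                   variation Q ≡ flip? (f (4 + n * 12)) (f 0) + changes f (4 + n * 12)
  variation-ring Q = trans (∣∷∣ (Q (prev zero) xor Q zero) (tabulate steps)) (cong₂ _+_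
    (cong₂ flip? (Q-at (fromℕ (4 + n * 12)) (toℕ-fromℕ _)) (Q-at zero refl))
    (trans (cong ∣_∣ {x = tabulate steps} (tabulate-cong λ i →
             cong₂ _xor_ (Q-at (inject₁ i) (toℕ-inject₁ i)) (Q-at (suc i) refl)))
           (changes-card (4 + n * 12) (λ i → Q (at i)))))
    where
    steps : Fin (4 + n * 12) → Bool
    steps i = Q (inject₁ i) xor Q (suc i)
    Q-at : ∀ i {a} → toℕ i ≡ a → Q i ≡ Q (at a)
    Q-at i refl = cong Q (sym (at-toℕ i))

  module _ (P : Fin (len n) → Bool) where

    private
      p q : ℕ → Bool
      p i = P (at i)
      q i = P (σ (at i))

    p-lookup : ∀ j → p (List.lookup (word n) j) ≡ q (toℕ j)
    p-lookup j = cong P (trans (trans (cong at (sym i≡)) (at-toℕ (σ j′)))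
                               (cong σ (trans (sym (at-toℕ j′)) (cong at (toℕ-cast (word-length n) j)))))
      where
      j′ : Fin (len n)
      j′ = cast (word-length n) j
      i≡ : toℕ (σ j′) ≡ List.lookup (word n) j
      i≡ = trans (σ-lookup j′) (cong (List.lookup (word n)) (cast-cast (word-length n) (sym (word-length n)) j))

    variation-word : variation (P ∘ σ) ≡ changesAround (map p (word n))
    variation-word rewrite p-lookup zero = trans (variation-ring (P ∘ σ)) (sym (cong₂ _+_
      (cong (λ b → flip? b (q 0)) (trans (proj₂ along) (cong q rest-length)))
      (trans (proj₁ along) (cong (changes q) rest-length))))
      where
      rest : List ℕ
      rest = 0 ∷ 3 + marker n ∷ 1 ∷ map (3 +_) (arc n)
      rest-length : length rest ≡ 4 + n * 12
      rest-length = ℕ.suc-injective (word-length n)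
      along = changesFrom-list p q rest (p-lookup ∘ suc)

  simple : Simple
  simple P ring≤ word≤
    with few n (λ i → P (at i)) (subst (_≤ 2) (variation-ring P) ring≤)
                                (subst (_≤ 2) (variation-word P) word≤)
  ... | inj₁ c≤1 = true , λ i j Pi Pj → toℕ-injective
    (count-unique (λ i → P (at i)) (len n) c≤1 (toℕ i) (toℕ j) (toℕ<n i) (toℕ<n j)
      (trans (cong P (at-toℕ i)) Pi) (trans (cong P (at-toℕ j)) Pj))
  ... | inj₂ c≤1 = false , λ i j Pi Pj → toℕ-injective
    (count-unique (λ i → not (P (at i))) (len n) c≤1 (toℕ i) (toℕ j) (toℕ<n i) (toℕ<n j)
      (cong not (trans (cong P (at-toℕ i)) Pi)) (cong not (trans (cong P (at-toℕ j)) Pj)))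

  connected : CyclicallyEdgeConnected G 5
  connected = cyclically-connected simple

  permutationSnark : PermutationSnark G
  permutationSnark = (cubic , factor , factor-permutation) ,
    cubic , (proj₁ connected , λ X X-cut → ℕ.≤-trans (ℕ.n≤1+n 4) (proj₂ connected X X-cut)) , girth simple ,
    λ (c , proper) → not-realised (λ s i → c (rim s i)) (colouring-realises c proper)

order-eq : ∀ n → (5 + n * 12) + (5 + n * 12) ≡ 10 + 24 * n
order-eq = solve-∀

theorem1p1 : (n : ℕ) →
    ∃[ G ] Graph.order G ≡ 10 + 24 * n
    × PermutationSnark G
    × CyclicallyEdgeConnected G 5
    × (∃[ F ] IsPermutationTwoFactor G F
    × (∀ S → IsCircuitDoubleCover G S → ¬ ContainedIn G F S))
theorem1p1 n = G , order-eq n , permutationSnark , connected , factor , factor-permutation ,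
  λ S cover contained → not-realised (label S cover contained) (cover-realises S cover contained)
  where open Family n
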